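{- Let $n\ge 3$ be an integer. (i) Let $a_1,\ldots,a_{n-1}$ be positive integers. Then $M_n(a_1,\ldots,a_{n-1},1)=\pm T$ if and only if $(a_1,\ldots,a_{n-1})$ is the quiddity of a notched $3d$-dissection of a convex polygon with $n$ vertices. (ii) Let $a_1,\ldots,a_n$ be positive integers with $a_n\ge 2$. Then $M_n(a_1,\ldots,a_n)=\pm T$ if and only if $(a_1,\ldots,a_n)$ is the quiddity of a capped $3d$-dissection of a convex polygon with $n+2$ vertices. Here $M_n(\cdot)=\pm T$ means $M_n(\cdot)\in\{T,-T\}$.
   Context: For integers $a_1,\ldots,a_n$ put $$M_n(a_1,\ldots,a_n)=\begin{pmatrix} a_n & -1\\ 1 & 0\end{pmatrix}\begin{pmatrix} a_{n-1} & -1\\ 1 & 0\end{pmatrix}\cdots\begin{pmatrix} a_1 & -1\\ 1 & 0\end{pmatrix}\in SL_2(\mathbb{Z}),\qquad T=\begin{pmatrix} 1 & 1\\ 0 & 1\end{pmatrix}.$$ Notched $3d$-dissection (French: 3$d$-dissection échancrée). Let $m\ge 5$ and let $P$ be a convex polygon with $m+1$ vertices. A notched $3d$-dissection of $P$ is a decomposition of $P$ into sub-polygons by diagonals of $P$ that cross only at vertices of $P$, such that: (1) exactly one of the sub-polygons is a quadrilateral; (2) every other sub-polygon of the decomposition has a number of vertices that is a multiple of $3$; (3) the quadrilateral has exactly two of its sides that are sides of $P$, and these two sides have a vertex in common. This common vertex is numbered $0$, and the other vertices of $P$ are then numbered $1,2,\ldots,m$ in counterclockwise order. For $1\le i\le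 m$, let $a_i$ be the number of sub-polygons whose number of vertices is a multiple of $3$ and which have vertex $i$ as one of their vertices. The sequence $(a_1,\ldots,a_m)$ is the quiddity of the notched $3d$-dissection. (For $m<5$ there are no notched $3d$-dissections of a polygon with $m+1$ vertices.) Capped $3d$-dissection (French: 3$d$-dissection coiffée). Let $n\ge 3$ and let $P$ be a convex polygon with $n+2$ vertices. A capped $3d$-dissection of $P$ is a decomposition of $P$ into sub-polygons by diagonals of $P$ that cross only at vertices of $P$, such that: (1) every sub-polygon of the decomposition has a number of vertices that is a multiple of $3$; (2) $P$ has an exterior triangle $\Delta$ (a triangle of the decomposition two of whose sides are sides of $P$) to which the weight $-1$ is assigned; (3) all the other sub-polygons receive the weight $1$; (4) the triangle $\Delta$ of weight $-1$ has a side in common with a triangle $\Delta'$ of weight $1$, and one of the sides of $\Delta'$ is a side of $P$. The vertex belonging only to $\Delta$ is numbered $0$, and the vertex belonging only to $\Delta$ and $\Delta'$ is numbered $-1$. The other vertices are numbered $1,\ldots,n$ consecutively around $P$ so that the vertex numbered $n$ is adjacent to the vertex numbered $-1$ (so the vertices of $P$ in cyclic order are $-1,0,1,2,\ldots,n$). For $1\le i\le n$, let $a_i$ be the sum of the weights of the sub-polygons having vertex $i$ as one of their vertices. The sequence $(a_1,\ldots,a_n)$ is the quiddity of the capped $3d$-dissection. -}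

module Defs where

open import Data.Bool.Base using (if_then_else_)
open import Data.Fin.Base using (toℕ)
open import Data.Integer.Base as ℤ using (ℤ; +_; 0ℤ; 1ℤ; -1ℤ)
open import Data.List.Base using (List; []; _∷_; filter; foldr; length; map; upTo)
open import Data.List.Membership.Propositional using (_∈_; _∉_)
open import Data.List.Properties using () renaming (≡-dec to ≡-decᴸ)
open import Data.List.Relation.Unary.All using (All)
open import Data.List.Relation.Unary.Any using (Any)
open import Data.List.Relation.Unary.Linked using (Linked)
open import Data.List.Relation.Unary.Unique.Propositional using (Unique)
open import Data.Nat.Base using (ℕ; suc; _<_; _≤_)
open import Data.Nat.Divisibility using (_∣_; _∣?_)
open import Data.Nat.Properties using (_≟_)
open import Data.Product.Base using (Σ-syntax; _×_; _,_)
open import Data.Product.Properties using () renaming (≡-dec to ≡-dec×)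
open import Data.Sum.Base using (_⊎_)
open import Data.Vec.Base using (Vec; []; _∷_; tabulate)
open import Function.Bundles using (_⇔_)
open import Relation.Binary.Definitions using (DecidableEquality)
open import Relation.Binary.PropositionalEquality using (_≡_; _≢_)
open import Relation.Nullary.Decidable using (does; _×-dec_)
open import Relation.Nullary.Negation using (¬_)

record Mat₂ : Set where
  constructor mat
  field
    e₁₁ e₁₂ e₂₁ e₂₂ : ℤ

infixl 7 _⊗_

_⊗_ : Mat₂ → Mat₂ → Mat₂
mat a b c d ⊗ mat a′ b′ c′ d′ =
  mat (a ℤ.* a′ ℤ.+ b ℤ.* c′) (a ℤ.* b′ ℤ.+ b ℤ.* d′)
      (c ℤ.* a′ ℤ.+ d ℤ.* c′) (c ℤ.* b′ ℤ.+ d ℤ.* d′)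

negate : Mat₂ → Mat₂
negate (mat a b c d) = mat (ℤ.- a) (ℤ.- b) (ℤ.- c) (ℤ.- d)

I T : Mat₂
I = mat 1ℤ 0ℤ 0ℤ 1ℤ
T = mat 1ℤ 1ℤ 0ℤ 1ℤ

-- The factor of the first entry stands rightmost in the product.
M : ∀ {n} → Vec ℤ n → Mat₂
M []       = I
M (a ∷ as) = M as ⊗ mat a -1ℤ 1ℤ 0ℤ

IsPlusMinusT : Mat₂ → Set
IsPlusMinusT A = A ≡ T ⊎ A ≡ negate T

-- A convex polygon with N vertices is modelled combinatorially: its vertices
-- are 0, …, N - 1 in cyclic (counterclockwise) order.  A polygon spanned by
-- some of these vertices is the strictly increasing list of its vertices, and
-- the segment joining vertices i < j is the pair (i , j).

Segment : Set
Segment = ℕ × ℕ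

_≟ˢ_ : DecidableEquality Segment
_≟ˢ_ = ≡-dec× _≟_ _≟_

_≟ᴾ_ : DecidableEquality (List ℕ)
_≟ᴾ_ = ≡-decᴸ _≟_

open import Data.List.Membership.DecPropositional _≟_ using () renaming (_∈?_ to _∈ᵛ?_)
open import Data.List.Membership.DecPropositional _≟ˢ_ using () renaming (_∈?_ to _∈ˢ?_)

_endpointOf_ : ℕ → Segment → Set
v endpointOf (i , j) = v ≡ i ⊎ v ≡ j

-- sides [v₀ < … < vₖ] is (v₀ , v₁), …, (vₖ₋₁ , vₖ), (v₀ , vₖ); the last one is
-- the closing side, with its smaller endpoint first like all segments.
sidesFrom : ℕ → List ℕ → List Segment
sidesFrom v₀ []           = []
sidesFrom v₀ (x ∷ [])     = (v₀ , x) ∷ []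
sidesFrom v₀ (x ∷ y ∷ vs) = (x , y) ∷ sidesFrom v₀ (y ∷ vs)

sides : List ℕ → List Segment
sides []       = []
sides (v ∷ vs) = sidesFrom v (v ∷ vs)

polygonSides : ℕ → List Segment
polygonSides N = sides (upTo N)

IsDiagonal : ℕ → Segment → Set
IsDiagonal N (i , j) = i < j × j < N × (i , j) ∉ polygonSides N

-- The two segments meet at a point that is interior to both.
Cross : Segment → Segment → Set
Cross (i , j) (k , l) = (i < k × k < j × j < l) ⊎ (k < i × i < l × l < j)

-- A sub-polygon cut out by a set of non-crossing diagonals: all its sides are
-- sides of P or chosen diagonals, and no chosen diagonal runs through its
-- interior.  (A diagonal entering the interior other than by joining two
-- vertices of the sub-polygon would cross one of its sides.)
record IsSubPolygon (N : ℕ) (ds : List Segment) (vs : List ℕ) : Set where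
  field
    increasing : Linked _<_ vs
    bounded    : All (_< N) vs
    atLeast3   : 3 ≤ length vs
    bounding   : All (λ s → s ∈ polygonSides N ⊎ s ∈ ds) (sides vs)
    uncut      : ∀ {i j} → i ∈ vs → j ∈ vs → (i , j) ∈ ds → (i , j) ∈ sides vs

-- The list of cells is determined by the diagonals up to order.
record Dissection (N : ℕ) : Set where
  field
    diagonals       : List Segment
    areDiagonals    : All (IsDiagonal N) diagonals
    nonCrossing     : ∀ {d e} → d ∈ diagonals → e ∈ diagonals → ¬ Cross d e
    cells           : List (List ℕ)
    cellsUnique     : Unique cells
    cells⇔subPolygon : ∀ vs → (vs ∈ cells) ⇔ IsSubPolygon N diagonals vs

sidesOnPolygon : ℕ → List ℕ → List Segment
sidesOnPolygon N vs = filter (_∈ˢ? polygonSides N) (sides vs)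

record NotchedDissection (m : ℕ) : Set where
  field
    5≤m        : 5 ≤ m
    dissection : Dissection (suc m)
  open Dissection dissection public
  field
    quad         : List ℕ
    quad∈cells   : quad ∈ cells
    quad-length  : length quad ≡ 4
    quad-unique  : ∀ {c} → c ∈ cells → length c ≡ 4 → c ≡ quad
    others-3∣    : ∀ {c} → c ∈ cells → c ≢ quad → 3 ∣ length c
    twoSides     : length (sidesOnPolygon (suc m) quad) ≡ 2
    -- The common vertex of these two sides is numbered 0.
    commonVertex : All (0 endpointOf_) (sidesOnPolygon (suc m) quad)

  cellCount : ℕ → ℕ
  cellCount i = length (filter (λ c → (3 ∣? length c) ×-dec (i ∈ᵛ? c)) cells)

  quiddity : Vec ℤ m
  quiddity = tabulate λ i → + cellCount (suc (toℕ i))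

-- The vertices -1, 0, 1, …, n of the numbering of a capped dissection are
-- represented by suc n, 0, 1, …, n respectively.
record CappedDissection (n : ℕ) : Set where
  field
    3≤n        : 3 ≤ n
    dissection : Dissection (suc (suc n))
  open Dissection dissection public
  field
    all-3∣      : ∀ {c} → c ∈ cells → 3 ∣ length c
    Δ           : List ℕ
    Δ∈cells     : Δ ∈ cells
    Δ-triangle  : length Δ ≡ 3
    Δ-exterior  : length (sidesOnPolygon (suc (suc n)) Δ) ≡ 2
    Δ′          : List ℕ
    Δ′∈cells    : Δ′ ∈ cells
    Δ′-triangle : length Δ′ ≡ 3
    Δ′≢Δ        : Δ′ ≢ Δ
    commonSide  : Any (_∈ sides Δ) (sides Δ′)
    Δ′-side     : Any (_∈ polygonSides (suc (suc n))) (sides Δ′)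
    vertex0     : ∀ {c} → c ∈ cells → (0 ∈ c) ⇔ (c ≡ Δ)
    vertex-1    : ∀ {c} → c ∈ cells → (suc n ∈ c) ⇔ (c ≡ Δ ⊎ c ≡ Δ′)

  weight : List ℕ → ℤ
  weight c = if does (c ≟ᴾ Δ) then -1ℤ else 1ℤ

  weightSum : ℕ → ℤ
  weightSum i = foldr ℤ._+_ 0ℤ (map weight (filter (i ∈ᵛ?_) cells))

  quiddity : Vec ℤ n
  quiddity = tabulate λ i → weightSum (suc (toℕ i))

IsNotchedQuiddity : ∀ {m} → Vec ℤ m → Set
IsNotchedQuiddity {m} a = Σ[ D ∈ NotchedDissection m ] NotchedDissection.quiddity D ≡ a

IsCappedQuiddity : ∀ {n} → Vec ℤ n → Set
IsCappedQuiddity {n} a = Σ[ D ∈ CappedDissection n ] CappedDissection.quiddity D ≡ a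

{-# OPTIONS --safe #-}
module Submission where

-- Up to sign, [x, 0, y] may be replaced by [x + y] in a word, and [0, 0] and
-- [1, 1, 1] may be erased. Hence if the word of the labels of one polygon is
-- trivial, gluing that polygon to a side of another one does not change the
-- word of the other. This gives M = ± I for the labels of any dissection whose
-- cells have trivial words themselves; a quadrilateral of weight 0 and a
-- triangle of weight -1 are such cells.
--
-- Conversely, a word with all letters ≥ 2 has too large an upper left entry. So
-- a positive word equivalent to () or (0) is 1^(3t) or 1^(3t+2), 2, 1^(3u+2),
-- respectively, or it contains x, 1^(3t+1), y with x, y ≥ 2, along which a
-- (3t+3)-gon is cut off; this keeps the word positive. As T = -M(0, 1), the
-- second part asks that (a₁, …, aₙ - 1) be trivial, and the first that
-- (a₁, …, aₙ₋₁) be equivalent to (0), which by the same reduction means that it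
-- arises from two trivial words by adding the last letter of one to the first
-- letter of the other.

open import Defs
open import Data.Bool.Base using (if_then_else_)
open import Data.Empty using (⊥; ⊥-elim)
open import Data.Fin.Base using (Fin; zero; suc; toℕ)
open import Data.Fin.Properties using (all?)
open import Data.Integer.Base using (ℤ; +_; ∣_∣; 0ℤ; 1ℤ; -1ℤ; _+_; _*_; _-_; -_; +≤+; +<+) renaming (_<_ to _<ℤ_; _≤_ to _≤ℤ_)
import Data.Integer.Properties as ℤ
import Data.Integer.Tactic.RingSolver as ℤ
open import Data.List.Base using (List; []; _∷_; _++_; [_]; length; upTo; applyUpTo; filter; foldr; map; replicate)
import Data.List.Membership.DecPropositional
open import Data.List.Membership.Propositional using (_∈_; _∉_)
open import Data.List.Membership.Propositional.Properties using (∈-upTo⁺; ∈-upTo⁻; ∈-++⁺ˡ; ∈-++⁺ʳ; ∈-++⁻; ∈-∃++; ∈-filter⁺; ∈-filter⁻)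
open import Data.List.Membership.Propositional.Properties.WithK using (unique∧set⇒bag)
import Data.List.Properties as List
open import Data.List.Relation.Binary.BagAndSetEquality using (∼bag⇒↭)
open import Data.List.Relation.Binary.Permutation.Propositional as Perm using (_↭_; prep; swap)
open import Data.List.Relation.Binary.Subset.Propositional using (_⊆_)
open import Data.List.Relation.Unary.All as All using ([]; _∷_) renaming (All to Allᴸ)
import Data.List.Relation.Unary.All.Properties as All
open import Data.List.Relation.Unary.AllPairs using (AllPairs; []; _∷_)
import Data.List.Relation.Unary.AllPairs.Properties as AllPairs
open import Data.List.Relation.Unary.Any using (here; there)
open import Data.List.Relation.Unary.Linked.Properties using (Linked⇒AllPairs; AllPairs⇒Linked)
open import Data.List.Relation.Unary.Unique.Propositional using (Unique)
import Data.List.Relation.Unary.Unique.Propositional.Properties as Unique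
open import Data.Nat.Base using (ℕ; zero; suc; s≤s; z≤n; _≤_; _<_)
import Data.Nat.Base as ℕ
open import Data.Nat.DivMod using (_divMod_; result)
open import Data.Nat.Divisibility using (_∣_; divides; _∣?_)
open import Data.Nat.Induction using (<-wellFounded)
import Data.Nat.Properties as ℕ
import Data.Nat.Tactic.RingSolver as ℕ
open import Data.Product.Base using (∃-syntax; _×_; _,_; proj₁; proj₂)
open import Data.Sum.Base using (_⊎_; inj₁; inj₂; [_,_]′)
open import Data.Unit.Base using (tt)
open import Data.Vec.Base using (Vec; []; _∷_; tabulate; toList; _∷ʳ_; last; initLast)
import Data.Vec.Properties as Vec
open import Data.Vec.Relation.Unary.All using (All; []; _∷_)
open import Function.Base using (_∘_)
open import Function.Bundles using (_⇔_; mk⇔; Equivalence)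
open import Induction.WellFounded using (Acc; acc)
open import Level using (0ℓ)
open import Relation.Binary.Core using (Rel)
open import Relation.Binary.Definitions using (Total; Transitive)
open import Relation.Binary.PropositionalEquality using (_≡_; _≢_; refl; sym; trans; cong; cong₂; subst; subst₂)
open import Relation.Nullary using (Dec; yes; no; does; contradiction; ¬_)
open import Relation.Nullary.Decidable using (from-yes; _×-dec_; _⊎-dec_; ¬?; dec-true; dec-false)
open import Relation.Unary using (Pred; Decidable)
open import Relation.Unary.Properties using (U?)

open Data.List.Membership.DecPropositional ℕ._≟_ using (_∈?_)
open Data.List.Membership.DecPropositional _≟ˢ_ using () renaming (_∈?_ to _∈ˢ?_)

-- Words in ℤ up to the sign of their matrix

-- The vertices outside the quiddity have forced labels. Vertex `0` of a notched dissection lies on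
-- the quadrilateral only, so the full word is 0, a₁, ..., aₘ, and it is trivial exactly when a₁,
-- ..., aₘ is equivalent to (0). In a capped dissection vertex `0` has label -1 and vertex `suc n`
-- has -1 + 1 = 0; the word -1, a₁, ..., aₙ, 0 is trivial exactly when a₁, ..., aₙ is equivalent to
-- (0, 1), that is, when its matrix is ± T. The geometric difficulty is that cells come without any
-- order of gluing: they are all the lists satisfying a condition relative to the diagonals. Cutting
-- and building both rest on the fact that, for a set of diagonals containing a chord, the cells are
-- precisely those of the two halves; the point there is that no cell has vertices strictly on both
-- sides of the chord. Weights are arbitrary functions on cells as long as possible, so that 1, 0
-- and -1 are treated at once.

mat-cong : ∀ {a b c d a′ b′ c′ d′} → a ≡ a′ → b ≡ b′ → c ≡ c′ → d ≡ d′ →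
           mat a b c d ≡ mat a′ b′ c′ d′
mat-cong refl refl refl refl = refl

⊗-assoc : ∀ A B C → (A ⊗ B) ⊗ C ≡ A ⊗ (B ⊗ C)
⊗-assoc (mat a b c d) (mat e f g h) (mat i j k l) = mat-cong (entry a b e f g h i k) (entry a b e f g h j l) (entry c d e f g h i k) (entry c d e f g h j l)
  where
  entry : ∀ a b e f g h i k → (a * e + b * g) * i + (a * f + b * h) * k ≡ a * (e * i + f * k) + b * (g * i + h * k)
  entry = ℤ.solve-∀

⊗-identityˡ : ∀ A → I ⊗ A ≡ A
⊗-identityˡ (mat a b c d) = mat-cong (one a c) (one b d) (two a c) (two b d)
  where
  one : ∀ a b → 1ℤ * a + 0ℤ * b ≡ a
  one = ℤ.solve-∀
  two : ∀ a b → 0ℤ * a + 1ℤ * b ≡ b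
  two = ℤ.solve-∀

⊗-identityʳ : ∀ A → A ⊗ I ≡ A
⊗-identityʳ (mat a b c d) = mat-cong (one a b) (two a b) (one c d) (two c d)
  where
  one : ∀ a b → a * 1ℤ + b * 0ℤ ≡ a
  one = ℤ.solve-∀
  two : ∀ a b → a * 0ℤ + b * 1ℤ ≡ b
  two = ℤ.solve-∀

negate-involutive : ∀ A → negate (negate A) ≡ A
negate-involutive (mat a b c d) = mat-cong (ℤ.neg-involutive a) (ℤ.neg-involutive b) (ℤ.neg-involutive c) (ℤ.neg-involutive d)

negate-⊗ˡ : ∀ A B → negate A ⊗ B ≡ negate (A ⊗ B)
negate-⊗ˡ (mat a b c d) (mat e f g h) = mat-cong (entry a b e g) (entry a b f h) (entry c d e g) (entry c d f h)
  where
  entry : ∀ a b e g → (- a) * e + (- b) * g ≡ - (a * e + b * g)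
  entry = ℤ.solve-∀

negate-⊗ʳ : ∀ A B → A ⊗ negate B ≡ negate (A ⊗ B)
negate-⊗ʳ (mat a b c d) (mat e f g h) = mat-cong (entry a b e g) (entry a b f h) (entry c d e g) (entry c d f h)
  where
  entry : ∀ a b e g → a * (- e) + b * (- g) ≡ - (a * e + b * g)
  entry = ℤ.solve-∀

infix 4 _≈_ _≋_

_≈_ : Mat₂ → Mat₂ → Set
A ≈ B = A ≡ B ⊎ A ≡ negate B

≈-sym : ∀ {A B} → A ≈ B → B ≈ A
≈-sym (inj₁ refl) = inj₁ refl
≈-sym {B = B} (inj₂ refl) = inj₂ (sym (negate-involutive B))

≈-trans : ∀ {A B C} → A ≈ B → B ≈ C → A ≈ C
≈-trans (inj₁ refl) q = q
≈-trans (inj₂ refl) (inj₁ refl) = inj₂ refl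
≈-trans {C = C} (inj₂ refl) (inj₂ refl) = inj₁ (negate-involutive C)

⊗-cong : ∀ {A B C D} → A ≈ B → C ≈ D → A ⊗ C ≈ B ⊗ D
⊗-cong (inj₁ refl) (inj₁ refl) = inj₁ refl
⊗-cong {B = B} {D = D} (inj₁ refl) (inj₂ refl) = inj₂ (negate-⊗ʳ B D)
⊗-cong {B = B} {D = D} (inj₂ refl) (inj₁ refl) = inj₂ (negate-⊗ˡ B D)
⊗-cong {B = B} {D = D} (inj₂ refl) (inj₂ refl) = inj₁ (trans (negate-⊗ˡ B (negate D)) (trans (cong negate (negate-⊗ʳ B D)) (negate-involutive (B ⊗ D))))

⟦_⟧ : List ℤ → Mat₂
⟦ [] ⟧     = I
⟦ a ∷ as ⟧ = ⟦ as ⟧ ⊗ mat a -1ℤ 1ℤ 0ℤ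

⟦⟧-++ : ∀ as bs → ⟦ as ++ bs ⟧ ≡ ⟦ bs ⟧ ⊗ ⟦ as ⟧
⟦⟧-++ [] bs = sym (⊗-identityʳ ⟦ bs ⟧)
⟦⟧-++ (a ∷ as) bs = trans (cong (_⊗ mat a -1ℤ 1ℤ 0ℤ) (⟦⟧-++ as bs)) (⊗-assoc ⟦ bs ⟧ ⟦ as ⟧ (mat a -1ℤ 1ℤ 0ℤ))

-- Wrapped in a record, so that the two words can be inferred from a proof.
record _≋_ (as bs : List ℤ) : Set where
  constructor word≈
  field matrix≈ : ⟦ as ⟧ ≈ ⟦ bs ⟧

≋-refl : ∀ {as} → as ≋ as
≋-refl = word≈ (inj₁ refl)

≋-reflexive : ∀ {as bs} → as ≡ bs → as ≋ bs
≋-reflexive refl = ≋-refl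

≋-sym : ∀ {as bs} → as ≋ bs → bs ≋ as
≋-sym (word≈ p) = word≈ (≈-sym p)

≋-trans : ∀ {as bs cs} → as ≋ bs → bs ≋ cs → as ≋ cs
≋-trans (word≈ p) (word≈ q) = word≈ (≈-trans p q)

++-cong : ∀ {as bs cs ds} → as ≋ bs → cs ≋ ds → as ++ cs ≋ bs ++ ds
++-cong {as} {bs} {cs} {ds} (word≈ p) (word≈ q) = word≈ (subst₂ _≈_ (sym (⟦⟧-++ as cs)) (sym (⟦⟧-++ bs ds)) (⊗-cong q p))

++-congˡ : ∀ as {bs cs} → bs ≋ cs → as ++ bs ≋ as ++ cs
++-congˡ as p = ++-cong (≋-refl {as}) p

++-congʳ : ∀ {as bs} cs → as ≋ bs → as ++ cs ≋ bs ++ cs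
++-congʳ cs p = ++-cong p (≋-refl {cs})

00≋[] : 0ℤ ∷ 0ℤ ∷ [] ≋ []
00≋[] = word≈ (inj₂ refl)

111≋[] : 1ℤ ∷ 1ℤ ∷ 1ℤ ∷ [] ≋ []
111≋[] = word≈ (inj₂ refl)

-- The factor of the letter a is T^a S, where S is the factor of 0 and S² = -I. Hence T^y S · S ·
-- T^x S = - T^(x+y) S.
x0y≋x+y : ∀ x y → x ∷ 0ℤ ∷ y ∷ [] ≋ x + y ∷ []
x0y≋x+y x y = word≈ (inj₂ (trans
  (cong (λ A → (A ⊗ m 0ℤ) ⊗ m x) (⊗-identityˡ (m y)))
  (trans (mat-cong (e₁ x y) (e₂ y) (e₃ x) refl) (cong negate (sym (⊗-identityˡ (m (x + y))))))))
  where
  m : ℤ → Mat₂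
  m a = mat a -1ℤ 1ℤ 0ℤ
  e₁ : ∀ x y → (y * 0ℤ + -1ℤ * 1ℤ) * x + (y * -1ℤ + 0ℤ) * 1ℤ ≡ - (x + y)
  e₁ = ℤ.solve-∀
  e₂ : ∀ y → (y * 0ℤ + -1ℤ * 1ℤ) * -1ℤ + (y * -1ℤ + 0ℤ) * 0ℤ ≡ 1ℤ
  e₂ = ℤ.solve-∀
  e₃ : ∀ x → 0ℤ * x + -1ℤ * 1ℤ ≡ - 1ℤ
  e₃ = ℤ.solve-∀

-- Positive words with matrix ± I or ± M 0

2ℤ : ℤ
2ℤ = + 2

inside : ∀ P R {as bs} → as ≋ bs → P ++ as ++ R ≋ P ++ bs ++ R
inside P R p = ++-congˡ P (++-congʳ R p)

-- Writing x + x′ as the word x′, 0, x isolates a subword that is trivial.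
glue≋ : ∀ P x x′ l y y′ R → x ∷ l ++ [ y ] ≋ [] →
        P ++ (x + x′) ∷ l ++ (y + y′) ∷ R ≋ P ++ x′ ∷ y′ ∷ R
glue≋ P x x′ l y y′ R p = ++-congˡ P (≋-trans (++-congʳ (l ++ (y + y′) ∷ R) x≋)
  (≋-trans (inside (x′ ∷ 0ℤ ∷ x ∷ l) R y≋)
  (≋-trans (≋-reflexive (cong (λ z → x′ ∷ 0ℤ ∷ z) (sym (List.++-assoc (x ∷ l) [ y ] (0ℤ ∷ y′ ∷ R)))))
  (≋-trans (inside (x′ ∷ 0ℤ ∷ []) (0ℤ ∷ y′ ∷ R) p)
           (inside [ x′ ] (y′ ∷ R) 00≋[])))))
  where
  x≋ : [ x + x′ ] ≋ x′ ∷ 0ℤ ∷ x ∷ []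
  x≋ = ≋-trans (≋-reflexive (cong [_] (ℤ.+-comm x x′))) (≋-sym (x0y≋x+y x′ x))
  y≋ : [ y + y′ ] ≋ y ∷ 0ℤ ∷ y′ ∷ []
  y≋ = ≋-sym (x0y≋x+y y y′)

ones : ℕ → List ℤ
ones n = replicate n 1ℤ

ones-+ : ∀ m n → ones (m ℕ.+ n) ≡ ones m ++ ones n
ones-+ zero    n = refl
ones-+ (suc m) n = cong (1ℤ ∷_) (ones-+ m n)

ones-∷ʳ : ∀ m → ones m ++ [ 1ℤ ] ≡ ones (suc m)
ones-∷ʳ zero    = refl
ones-∷ʳ (suc m) = cong (1ℤ ∷_) (ones-∷ʳ m)

ones-3* : ∀ t → ones (t ℕ.* 3) ≋ []
ones-3* zero    = ≋-refl
ones-3* (suc t) = ≋-trans (++-congʳ (ones (t ℕ.* 3)) 111≋[]) (ones-3* t)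

ones-mod : ∀ r t → ones (r ℕ.+ t ℕ.* 3) ≋ ones r
ones-mod r t = ≋-trans (≋-reflexive (ones-+ r (t ℕ.* 3)))
  (≋-trans (++-congˡ (ones r) (ones-3* t)) (≋-reflexive (List.++-identityʳ (ones r))))

ear≋ : ∀ P x t y R → P ++ (1ℤ + x) ∷ ones (1 ℕ.+ t ℕ.* 3) ++ (1ℤ + y) ∷ R ≋ P ++ x ∷ y ∷ R
ear≋ P x t y R = glue≋ P 1ℤ x (ones (1 ℕ.+ t ℕ.* 3)) 1ℤ y R
  (≋-trans (≋-reflexive (cong (1ℤ ∷_) (ones-∷ʳ (1 ℕ.+ t ℕ.* 3)))) (ones-3* (suc t)))

-- Writing x as x - 1, 0, 1 completes the two ones to the trivial word 1, 1, 1.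
x11y≋ : ∀ x y → x ∷ 1ℤ ∷ 1ℤ ∷ y ∷ [] ≋ [ x - 1ℤ + y ]
x11y≋ x y = ≋-trans (++-congʳ (1ℤ ∷ 1ℤ ∷ [ y ]) x≋)
  (≋-trans (inside (x - 1ℤ ∷ 0ℤ ∷ []) [ y ] 111≋[]) (x0y≋x+y (x - 1ℤ) y))
  where
  eq : ∀ x → x ≡ (x - 1ℤ) + 1ℤ
  eq = ℤ.solve-∀
  x≋ : [ x ] ≋ x - 1ℤ ∷ 0ℤ ∷ 1ℤ ∷ []
  x≋ = ≋-trans (≋-reflexive (cong [_] (eq x))) (≋-sym (x0y≋x+y (x - 1ℤ) 1ℤ))

open Mat₂

-- If the first row is A, B, a further letter c turns it into A c + B, - A. For c ≥ 2 this gives A c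
-- + B ≥ (A + B) + A and (A c + B) - A ≥ A + B. So A grows by at least 1 with each letter, provided
-- that the bound on A + B is carried along.
growth : ∀ {cs} → Allᴸ (2ℤ ≤ℤ_) cs →
         (+ suc (length cs) ≤ℤ e₁₁ ⟦ cs ⟧) × (1ℤ ≤ℤ e₁₁ ⟦ cs ⟧ + e₁₂ ⟦ cs ⟧)
growth [] = ℤ.≤-refl , ℤ.≤-refl
growth {c ∷ cs} (+≤+ {n = suc (suc n)} (s≤s (s≤s z≤n)) ∷ cs≥2) with ⟦ cs ⟧ | growth cs≥2
... | mat A@(+ a) B C D | +≤+ len≤A , 1≤A+B =
    ℤ.≤-trans (ℤ.≤-trans (ℤ.+-mono-≤ 1≤A+B (+≤+ len≤A)) (add (A + B + A))) (ℤ.≤-reflexive (eq₁ A B (+ n)))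
  , ℤ.≤-trans (ℤ.≤-trans 1≤A+B (add (A + B))) (ℤ.≤-reflexive (eq₂ A B (+ n)))
  where
  add : ∀ x → x ≤ℤ x + A * + n
  add x rewrite sym (ℤ.pos-* a n) = ℤ.i≤i+j x (+ (a ℕ.* n))
  eq₁ : ∀ A B n → A + B + A + A * n ≡ A * (2ℤ + n) + B * 1ℤ
  eq₁ = ℤ.solve-∀
  eq₂ : ∀ A B n → A + B + A * n ≡ (A * (2ℤ + n) + B * 1ℤ) + (A * -1ℤ + B * 0ℤ)
  eq₂ = ℤ.solve-∀

-- As x, 1, 1, y is equivalent to x - 1 + y, a factor without ears is equivalent
-- to a word with all letters ≥ 2.
record Core (k : List ℤ) : Set where
  constructor mkCore
  field
    {first}   : ℤ
    {rest}    : List ℤ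
    k≡        : k ≡ first ∷ rest
    first≥2   : 2ℤ ≤ℤ first
    {c}       : ℤ
    {cs}      : List ℤ
    k≋        : k ≋ c ∷ cs
    cs≥2      : Allᴸ (2ℤ ≤ℤ_) (c ∷ cs)
    k≡[2]     : c ∷ cs ≡ [ 2ℤ ] → k ≡ [ 2ℤ ]

data Shape : List ℤ → Set where
  flat : ∀ p → Shape (ones p)
  core : ∀ p {k} q → Core k → Shape (ones p ++ k ++ ones q)
  ear  : ∀ P x t y R → 2ℤ ≤ℤ x → 2ℤ ≤ℤ y → Shape (P ++ x ∷ ones (1 ℕ.+ t ℕ.* 3) ++ y ∷ R)

shape-1∷ : ∀ {l} → Shape l → Shape (1ℤ ∷ l)
shape-1∷ (flat p)            = flat (suc p)
shape-1∷ (core p q c)        = core (suc p) q c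
shape-1∷ (ear P x t y R p q) = ear (1ℤ ∷ P) x t y R p q

-- Only the number of ones ahead of the next letter ≥ 2 matters, modulo 3. Remainder 0: they cancel,
-- and `x` joins the reduced word. Remainder 1: they form an ear with `x` and `first`. Remainder 2:
-- `x` and `c` merge into `x - 1ℤ + c`.
shape-∷ : ∀ {x l} → 2ℤ ≤ℤ x → Shape l → Shape (x ∷ l)
shape-∷ 2≤x (flat q) = core 0 q (mkCore refl 2≤x ≋-refl (2≤x ∷ []) (λ eq → eq))
shape-∷ 2≤x (ear P y t z R p q) = ear (_ ∷ P) y t z R p q
shape-∷ {x} 2≤x (core p {k} q (mkCore k≡ first≥2 {c} {cs} k≋ (2≤c ∷ cs≥2) k≡[2])) with p divMod 3
... | result t zero refl =
  subst Shape (List.++-assoc (x ∷ ones (t ℕ.* 3)) k (ones q))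
    (core 0 q (mkCore refl 2≤x
      (≋-trans (inside [ x ] k (ones-3* t)) (++-congˡ [ x ] k≋))
      (2≤x ∷ 2≤c ∷ cs≥2) (λ ())))
... | result t (suc zero) refl rewrite k≡ =
  ear [] x t _ _ 2≤x first≥2
... | result t (suc (suc zero)) refl =
  subst Shape (List.++-assoc (x ∷ ones (2 ℕ.+ t ℕ.* 3)) k (ones q))
    (core 0 q (mkCore refl 2≤x
      (≋-trans (inside [ x ] k (ones-mod 2 t))
        (≋-trans (++-congˡ (x ∷ ones 2) k≋) (++-congʳ cs (x11y≋ x c))))
      (ℤ.≤-trans (+≤+ (s≤s (s≤s z≤n))) 3≤ ∷ cs≥2)
      (λ eq → contradiction (subst (+ 3 ≤ℤ_) (List.∷-injectiveˡ eq) 3≤) λ { (+≤+ (s≤s (s≤s ()))) })))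
  where
  -- A merged letter is at least 3, so a reduced word `[ 2ℤ ]` comes from `k ≡ [ 2ℤ ]` alone. This
  -- lets `core≋[0]` recover the letters of `k` and not only its class.
  3≤ : + 3 ≤ℤ x - 1ℤ + c
  3≤ = ℤ.+-mono-≤ (ℤ.+-mono-≤ 2≤x (ℤ.≤-refl { -1ℤ})) 2≤c

0<⇒≡1⊎2≤ : ∀ {x} → 0ℤ <ℤ x → x ≡ 1ℤ ⊎ 2ℤ ≤ℤ x
0<⇒≡1⊎2≤ (+<+ {n = suc zero}    _) = inj₁ refl
0<⇒≡1⊎2≤ (+<+ {n = suc (suc n)} _) = inj₂ (+≤+ (s≤s (s≤s z≤n)))

shape : ∀ {l} → Allᴸ (0ℤ <ℤ_) l → Shape l
shape []        = flat 0
shape (0<x ∷ 0<l) with 0<⇒≡1⊎2≤ 0<x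
... | inj₁ refl = shape-1∷ (shape 0<l)
... | inj₂ 2≤x  = shape-∷ 2≤x (shape 0<l)

-- As 1, 1, 1 is trivial, `ones (complement r)` inverts any block of ones whose length has remainder
-- `r` modulo 3.
complement : Fin 3 → ℕ
complement zero             = 0
complement (suc zero)       = 2
complement (suc (suc zero)) = 1

complementˡ : ∀ r t → ones (complement r) ++ ones (toℕ r ℕ.+ t ℕ.* 3) ≋ []
complementˡ zero             t = ones-3* t
complementˡ (suc zero)       t = ones-3* (suc t)
complementˡ (suc (suc zero)) t = ones-3* (suc t)

complementʳ : ∀ r t → ones (toℕ r ℕ.+ t ℕ.* 3) ++ ones (complement r) ≋ []
complementʳ r t = ≋-trans (≋-reflexive (trans (sym (ones-+ n m)) (trans (cong ones (ℕ.+-comm n m)) (ones-+ m n))))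
  (complementˡ r t)
  where
  n = toℕ r ℕ.+ t ℕ.* 3
  m = complement r

core≋ : ∀ {k g} r t s u → ones (toℕ r ℕ.+ t ℕ.* 3) ++ k ++ ones (toℕ s ℕ.+ u ℕ.* 3) ≋ g →
        k ≋ ones (complement r) ++ g ++ ones (complement s)
core≋ {k} {g} r t s u eq = ≋-sym (≋-trans (inside r′ s′ (≋-sym eq))
  (≋-trans (≋-reflexive assoc)
  (≋-trans (++-congʳ (k ++ q ++ s′) (complementˡ r t))
  (≋-trans (++-congˡ k (complementʳ s u)) (≋-reflexive (List.++-identityʳ k))))))
  where
  r′ = ones (complement r)
  s′ = ones (complement s)
  p = ones (toℕ r ℕ.+ t ℕ.* 3)
  q = ones (toℕ s ℕ.+ u ℕ.* 3)
  assoc : r′ ++ (p ++ k ++ q) ++ s′ ≡ (r′ ++ p) ++ k ++ q ++ s′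
  assoc = trans (cong (r′ ++_) (trans (List.++-assoc p (k ++ q) s′) (cong (p ++_) (List.++-assoc k q s′))))
                (sym (List.++-assoc r′ p (k ++ q ++ s′)))

core-large : ∀ {c cs w} → Allᴸ (2ℤ ≤ℤ_) (c ∷ cs) → c ∷ cs ≋ w → suc (suc (length cs)) ≤ ∣ e₁₁ ⟦ w ⟧ ∣
core-large {c} {cs} {w} cs≥2 eq with e₁₁ ⟦ c ∷ cs ⟧ | proj₁ (growth cs≥2) | abs eq
  where
  abs : c ∷ cs ≋ w → ∣ e₁₁ ⟦ c ∷ cs ⟧ ∣ ≡ ∣ e₁₁ ⟦ w ⟧ ∣
  abs (word≈ (inj₁ eq)) = cong ∣_∣ (cong e₁₁ eq)
  abs (word≈ (inj₂ eq)) = trans (cong ∣_∣ (cong e₁₁ eq)) (ℤ.∣-i∣≡∣i∣ (e₁₁ ⟦ w ⟧))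
... | + n | +≤+ len≤n | refl = len≤n

-- Moved to the other side, the outer ones leave one of nine words there. By evaluation each of
-- these has an upper left entry of absolute value at most 1, while the reduced core needs at least
-- 2.
core≋̸[] : ∀ p {k} q → Core k → ¬ (ones p ++ k ++ ones q ≋ [])
core≋̸[] p q (mkCore _ _ k≋ cs≥2 _) eq with p divMod 3 | q divMod 3
... | result t r refl | result u s refl = contradiction
  (ℕ.≤-trans (core-large cs≥2 (≋-trans (≋-sym k≋) (core≋ r t s u eq))) (small r s))
  λ { (s≤s ()) }
  where
  small : ∀ r s → ∣ e₁₁ ⟦ ones (complement r) ++ [] ++ ones (complement s) ⟧ ∣ ≤ 1
  small = from-yes (all? λ r → all? λ s → ∣ e₁₁ ⟦ ones (complement r) ++ [] ++ ones (complement s) ⟧ ∣ ℕ.≤? 1)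

core≋[0] : ∀ p {k} q → Core k → ones p ++ k ++ ones q ≋ [ 0ℤ ] →
           ∃[ t ] ∃[ u ] ones p ++ k ++ ones q ≡ ones (2 ℕ.+ t ℕ.* 3) ++ 2ℤ ∷ ones (2 ℕ.+ u ℕ.* 3)
core≋[0] p {k} q (mkCore _ _ {c} {cs} k≋ cs≥2 k≡[2]) eq with p divMod 3 | q divMod 3
... | result t r refl | result u s refl = two r s (small r s) cs≋ (core-large cs≥2 cs≋)
  where
  cs≋ = ≋-trans (≋-sym k≋) (core≋ r t s u eq)
  w : Fin 3 → Fin 3 → List ℤ
  w r s = ones (complement r) ++ [ 0ℤ ] ++ ones (complement s)
  -- The exception is the word 1, 0, 1, equivalent to (2). Its upper left entry -2 leaves room for a
  -- single letter, which must be 2.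
  small : ∀ r s → ∣ e₁₁ ⟦ w r s ⟧ ∣ ≤ 1 ⊎ (toℕ r ≡ 2 × toℕ s ≡ 2)
  small = from-yes (all? λ r → all? λ s → (∣ e₁₁ ⟦ w r s ⟧ ∣ ℕ.≤? 1) ⊎-dec ((toℕ r ℕ.≟ 2) ×-dec (toℕ s ℕ.≟ 2)))
  two : ∀ r s → ∣ e₁₁ ⟦ w r s ⟧ ∣ ≤ 1 ⊎ (toℕ r ≡ 2 × toℕ s ≡ 2) → c ∷ cs ≋ w r s →
        suc (suc (length cs)) ≤ ∣ e₁₁ ⟦ w r s ⟧ ∣ →
        ∃[ t′ ] ∃[ u′ ] ones (toℕ r ℕ.+ t ℕ.* 3) ++ k ++ ones (toℕ s ℕ.+ u ℕ.* 3) ≡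
                        ones (2 ℕ.+ t′ ℕ.* 3) ++ 2ℤ ∷ ones (2 ℕ.+ u′ ℕ.* 3)
  two r s (inj₁ ≤1) _ large = contradiction (ℕ.≤-trans large ≤1) λ { (s≤s ()) }
  two (suc (suc zero)) (suc (suc zero)) (inj₂ _) eq large =
    t , u , cong (λ l → ones (2 ℕ.+ t ℕ.* 3) ++ l ++ ones (2 ℕ.+ u ℕ.* 3)) (k≡[2] (cs≡[2] cs cs≥2 eq large))
    where
    c≡ : ∀ c → c ≡ 1ℤ * c + 0ℤ * 1ℤ
    c≡ = ℤ.solve-∀
    cs≡[2] : ∀ cs → Allᴸ (2ℤ ≤ℤ_) (c ∷ cs) → c ∷ cs ≋ 1ℤ ∷ 0ℤ ∷ 1ℤ ∷ [] →
             suc (suc (length cs)) ≤ 2 → c ∷ cs ≡ [ 2ℤ ]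
    cs≡[2] (_ ∷ _) _ _ (s≤s (s≤s ()))
    cs≡[2] [] (2≤c ∷ []) (word≈ (inj₁ eq)) _ =
      contradiction (subst (2ℤ ≤ℤ_) (trans (c≡ c) (cong e₁₁ eq)) 2≤c) λ ()
    cs≡[2] [] _ (word≈ (inj₂ eq)) _ = cong [_] (trans (c≡ c) (cong e₁₁ eq))

flat≋[] : ∀ p → ones p ≋ [] → ∃[ t ] p ≡ t ℕ.* 3
flat≋[] p eq with p divMod 3
... | result t r refl = t , cong (ℕ._+ t ℕ.* 3) (r≡0 r (≋-trans (≋-sym (ones-mod (toℕ r) t)) eq))
  where
  r≡0 : ∀ (r : Fin 3) → ones (toℕ r) ≋ [] → toℕ r ≡ 0
  r≡0 zero             _ = refl
  r≡0 (suc zero)       (word≈ (inj₁ ()))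
  r≡0 (suc zero)       (word≈ (inj₂ ()))
  r≡0 (suc (suc zero)) (word≈ (inj₁ ()))
  r≡0 (suc (suc zero)) (word≈ (inj₂ ()))

flat≋̸[0] : ∀ p → ¬ (ones p ≋ [ 0ℤ ])
flat≋̸[0] p eq with p divMod 3
... | result t r refl = absurd r (≋-trans (≋-sym (ones-mod (toℕ r) t)) eq)
  where
  absurd : ∀ (r : Fin 3) → ¬ (ones (toℕ r) ≋ [ 0ℤ ])
  absurd zero             (word≈ (inj₁ ()))
  absurd zero             (word≈ (inj₂ ()))
  absurd (suc zero)       (word≈ (inj₁ ()))
  absurd (suc zero)       (word≈ (inj₂ ()))
  absurd (suc (suc zero)) (word≈ (inj₁ ()))
  absurd (suc (suc zero)) (word≈ (inj₂ ()))

-- Quiddities of 3d-dissections, built by gluing (3t+3)-gons to a side.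
data Quiddity : List ℤ → Set where
  polygon : ∀ t → Quiddity (ones (suc t ℕ.* 3))
  glueEar : ∀ P x t y R → Quiddity (P ++ x ∷ y ∷ R) →
            Quiddity (P ++ (1ℤ + x) ∷ ones (1 ℕ.+ t ℕ.* 3) ++ (1ℤ + y) ∷ R)

Positive : List ℤ → Set
Positive = Allᴸ (0ℤ <ℤ_)

2≤⇒pred : ∀ {x} → 2ℤ ≤ℤ x → ∃[ x′ ] (0ℤ <ℤ x′ × x ≡ 1ℤ + x′)
2≤⇒pred (+≤+ {n = suc (suc n)} (s≤s (s≤s z≤n))) = + suc n , +<+ (s≤s z≤n) , refl

cut-positive : ∀ P {x} t {y} R → 0ℤ <ℤ x → 0ℤ <ℤ y →
  Positive (P ++ (1ℤ + x) ∷ ones (1 ℕ.+ t ℕ.* 3) ++ (1ℤ + y) ∷ R) → Positive (P ++ x ∷ y ∷ R)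
cut-positive P {x} t R 0<x 0<y pos with All.++⁻ P pos
... | posP , _ ∷ pos′ with All.++⁻ʳ (ones (1 ℕ.+ t ℕ.* 3)) pos′
... | _ ∷ posR = All.++⁺ posP (0<x ∷ 0<y ∷ posR)

cut-length : ∀ P {x x′ : ℤ} t {y y′} R → length (P ++ x ∷ y ∷ R) < length (P ++ x′ ∷ ones (1 ℕ.+ t ℕ.* 3) ++ y′ ∷ R)
cut-length (_ ∷ P) t R = s≤s (cut-length P t R)
cut-length []      t R = s≤s (s≤s (longer (t ℕ.* 3) R))
  where
  longer : ∀ n {y′} R → suc (length R) ≤ length (ones n ++ y′ ∷ R)
  longer zero    R = ℕ.≤-refl
  longer (suc n) R = ℕ.≤-trans (longer n R) (ℕ.n≤1+n _)

++-nonempty : ∀ (P : List ℤ) {x R} → P ++ x ∷ R ≢ []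
++-nonempty []      ()
++-nonempty (_ ∷ _) ()

≋[]⇒quiddity : ∀ l → Positive l → l ≢ [] → l ≋ [] → Quiddity l
≋[]⇒quiddity l = go l (<-wellFounded (length l))
  where
  go : ∀ l → Acc _<_ (length l) → Positive l → l ≢ [] → l ≋ [] → Quiddity l
  go l (acc rs) pos l≢[] l≋[] with shape pos
  ... | core p q c = contradiction l≋[] (core≋̸[] p q c)
  ... | flat p with flat≋[] p l≋[]
  -- The empty word is trivial but labels no polygon.
  ...   | zero  , refl = contradiction refl l≢[]
  ...   | suc t , refl = polygon t
  go l (acc rs) pos l≢[] l≋[] | ear P x t y R 2≤x 2≤y with 2≤⇒pred 2≤x | 2≤⇒pred 2≤y
  ... | x′ , 0<x , refl | y′ , 0<y , refl =
    glueEar P x′ t y′ R (go _ (rs (cut-length P t R)) (cut-positive P t R 0<x 0<y pos)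
      (++-nonempty P) (≋-trans (≋-sym (ear≋ P x′ t y′ R)) l≋[]))

quiddity-length : ∀ {l} → Quiddity l → 3 ≤ length l
quiddity-length (polygon t)           = s≤s (s≤s (s≤s z≤n))
quiddity-length (glueEar P x t y R q) = ℕ.≤-trans (quiddity-length q) (ℕ.<⇒≤ (cut-length P t R))

-- Splitting a positive word equivalent to (0)

data Position (P : List ℤ) (x y : ℤ) (R b : List ℤ) (z : ℤ) (c : List ℤ) : Set where
  left   : ∀ e → P ≡ b ++ z ∷ e → c ≡ e ++ x ∷ y ∷ R → Position P x y R b z c
  at-x   : P ≡ b → x ≡ z → c ≡ y ∷ R → Position P x y R b z c
  at-y   : b ≡ P ++ [ x ] → y ≡ z → R ≡ c → Position P x y R b z c
  right  : ∀ e → b ≡ P ++ x ∷ y ∷ e → R ≡ e ++ z ∷ c → Position P x y R b z c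

position : ∀ P {x y R} b {z c} → P ++ x ∷ y ∷ R ≡ b ++ z ∷ c → Position P x y R b z c
position []      []          refl = at-x refl refl refl
position []      (_ ∷ [])    refl = at-y refl refl refl
position []      (_ ∷ _ ∷ b) refl = right b refl refl
position (_ ∷ P) []          refl = left P refl refl
position (p ∷ P) (b₀ ∷ b) eq with List.∷-injectiveˡ eq | position P b (List.∷-injectiveʳ eq)
... | refl | left e eq₁ eq₂    = left e (cong (p ∷_) eq₁) eq₂
... | refl | at-x eq₁ eq₂ eq₃  = at-x (cong (p ∷_) eq₁) eq₂ eq₃
... | refl | at-y eq₁ eq₂ eq₃  = at-y (cong (p ∷_) eq₁) eq₂ eq₃
... | refl | right e eq₁ eq₂   = right e (cong (p ∷_) eq₁) eq₂

-- `x` and `y` are the labels that two dissections give to a common vertex, the corner of the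
-- quadrilateral opposite to vertex `0`; `b` and `c` hold their remaining labels.
record Split (l : List ℤ) : Set where
  constructor split
  field
    b     : List ℤ
    x y   : ℤ
    c     : List ℤ
    l≡    : l ≡ b ++ (x + y) ∷ c
    b+>0  : Positive (b ++ [ x ])
    +c>0  : Positive (y ∷ c)
    b≋    : b ++ [ x ] ≋ []
    c≋    : y ∷ c ≋ []

ones>0 : ∀ n → Positive (ones n)
ones>0 zero    = []
ones>0 (suc n) = +<+ (s≤s z≤n) ∷ ones>0 n

glueEar-positive : ∀ P {x} n {y} R → Positive (P ++ x ∷ y ∷ R) →
                   Positive (P ++ (1ℤ + x) ∷ ones n ++ (1ℤ + y) ∷ R)
glueEar-positive P n R pos with All.++⁻ P pos
... | posP , 0<x ∷ 0<y ∷ posR = All.++⁺ posP (0<suc 0<x ∷ All.++⁺ (ones>0 n) (0<suc 0<y ∷ posR))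
  where
  0<suc : ∀ {x} → 0ℤ <ℤ x → 0ℤ <ℤ 1ℤ + x
  0<suc 0<x = ℤ.+-mono-< (+<+ (s≤s z≤n)) 0<x

-- The ear is glued to whichever half contains the pair `x`, `y`. If the split letter belongs to the
-- pair, its increment goes to the half that contains the other letter of the pair: the right half
-- in `at-x`, the left one in `at-y`.
split-glueEar : ∀ P x t y R → Split (P ++ x ∷ y ∷ R) →
                Split (P ++ (1ℤ + x) ∷ ones (1 ℕ.+ t ℕ.* 3) ++ (1ℤ + y) ∷ R)
split-glueEar P x t y R (split b u v c l≡ b>0 c>0 b≋ c≋) = case (position P b l≡)
  where
  n = 1 ℕ.+ t ℕ.* 3
  case : Position P x y R b (u + v) c → Split (P ++ (1ℤ + x) ∷ ones n ++ (1ℤ + y) ∷ R)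
  case (left e refl refl) = split b u v (e ++ (1ℤ + x) ∷ ones n ++ (1ℤ + y) ∷ R)
    (List.++-assoc b ((u + v) ∷ e) _) b>0 (glueEar-positive (v ∷ e) n R c>0)
    b≋ (≋-trans (ear≋ (v ∷ e) x t y R) c≋)
  case (at-x refl refl refl) = split b u (1ℤ + v) (ones n ++ (1ℤ + y) ∷ R)
    (cong (λ z → b ++ z ∷ ones n ++ (1ℤ + y) ∷ R) (shift u v)) b>0 (glueEar-positive [] n R c>0)
    b≋ (≋-trans (ear≋ [] v t y R) c≋)
    where
    shift : ∀ u v → 1ℤ + (u + v) ≡ u + (1ℤ + v)
    shift = ℤ.solve-∀
  case (at-y refl refl refl) = split (P ++ (1ℤ + x) ∷ ones n) (1ℤ + u) v c
    (trans (cong (λ z → P ++ (1ℤ + x) ∷ ones n ++ z ∷ R) (sym (ℤ.+-assoc 1ℤ u v)))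
           (sym (List.++-assoc P ((1ℤ + x) ∷ ones n) _)))
    (subst Positive (sym (List.++-assoc P _ _)) (glueEar-positive P n [] (subst Positive (List.++-assoc P _ _) b>0)))
    c>0
    (≋-trans (≋-reflexive (List.++-assoc P _ _)) (≋-trans (ear≋ P x t u [])
      (≋-trans (≋-reflexive (sym (List.++-assoc P _ _))) b≋)))
    c≋
  case (right e refl refl) = split (P ++ (1ℤ + x) ∷ ones n ++ (1ℤ + y) ∷ e) u v c
    (trans (cong (λ l → P ++ (1ℤ + x) ∷ l) (sym (List.++-assoc (ones n) _ _)))
           (sym (List.++-assoc P _ _)))
    (subst Positive (sym assoc) (glueEar-positive P n (e ++ [ u ]) (subst Positive (List.++-assoc P _ _) b>0)))
    c>0
    (≋-trans (≋-reflexive assoc) (≋-trans (ear≋ P x t y (e ++ [ u ]))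
      (≋-trans (≋-reflexive (sym (List.++-assoc P _ _))) b≋)))
    c≋
    where
    assoc : (P ++ (1ℤ + x) ∷ ones n ++ (1ℤ + y) ∷ e) ++ [ u ] ≡ P ++ (1ℤ + x) ∷ ones n ++ (1ℤ + y) ∷ e ++ [ u ]
    assoc = trans (List.++-assoc P _ _) (cong (λ l → P ++ (1ℤ + x) ∷ l) (List.++-assoc (ones n) _ _))

≋[0]⇒split : ∀ l → Positive l → l ≋ [ 0ℤ ] → Split l
≋[0]⇒split l = go l (<-wellFounded (length l))
  where
  triangles : ∀ t u → Split (ones (2 ℕ.+ t ℕ.* 3) ++ 2ℤ ∷ ones (2 ℕ.+ u ℕ.* 3))
  triangles t u = split (ones (2 ℕ.+ t ℕ.* 3)) 1ℤ 1ℤ (ones (2 ℕ.+ u ℕ.* 3)) refl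
    (subst Positive (sym (ones-∷ʳ (2 ℕ.+ t ℕ.* 3))) (ones>0 (suc t ℕ.* 3))) (ones>0 (suc u ℕ.* 3))
    (≋-trans (≋-reflexive (ones-∷ʳ (2 ℕ.+ t ℕ.* 3))) (ones-3* (suc t))) (ones-3* (suc u))
  go : ∀ l → Acc _<_ (length l) → Positive l → l ≋ [ 0ℤ ] → Split l
  go l (acc rs) pos l≋[0] with shape pos
  ... | flat p = contradiction l≋[0] (flat≋̸[0] p)
  ... | core p q c with core≋[0] p q c l≋[0]
  ...   | t , u , eq = subst Split (sym eq) (triangles t u)
  go l (acc rs) pos l≋[0] | ear P x t y R 2≤x 2≤y with 2≤⇒pred 2≤x | 2≤⇒pred 2≤y
  ... | x′ , 0<x , refl | y′ , 0<y , refl =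
    split-glueEar P x′ t y′ R (go _ (rs (cut-length P t R)) (cut-positive P t R 0<x 0<y pos)
      (≋-trans (≋-sym (ear≋ P x′ t y′ R)) l≋[0]))

-- Sides and cells

Sorted : List ℕ → Set
Sorted = AllPairs _<_

sorted-ext : ∀ {xs ys} → Sorted xs → Sorted ys → xs ⊆ ys → ys ⊆ xs → xs ≡ ys
sorted-ext [] [] _ _ = refl
sorted-ext [] (_ ∷ _) _ sup with sup (here refl)
... | ()
sorted-ext (_ ∷ _) [] sub _ with sub (here refl)
... | ()
sorted-ext {x ∷ xs} {y ∷ ys} (x< ∷ xs↗) (y< ∷ ys↗) sub sup with heads (sub (here refl)) (sup (here refl))
  where
  heads : x ∈ y ∷ ys → y ∈ x ∷ xs → x ≡ y
  heads (here x≡y) _           = x≡y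
  heads (there _)  (here y≡x)  = sym y≡x
  heads (there x∈) (there y∈)  = contradiction (All.lookup y< x∈) (ℕ.<-asym (All.lookup x< y∈))
... | refl = cong (x ∷_) (sorted-ext xs↗ ys↗ (tails x< sub) (tails y< sup))
  where
  tails : ∀ {zs ws} → Allᴸ (x <_) zs → (x ∷ zs) ⊆ (x ∷ ws) → zs ⊆ ws
  tails x<zs sub z∈ with sub (there z∈)
  ... | here refl = contradiction (All.lookup x<zs z∈) (ℕ.<-irrefl refl)
  ... | there z∈′ = z∈′

module Extremum (_≼_ : Rel ℕ 0ℓ) (total : Total _≼_) (≼-trans : Transitive _≼_) where

  ≼-refl : ∀ {x} → x ≼ x
  ≼-refl {x} with total x x
  ... | inj₁ p = p
  ... | inj₂ p = p

  extremum : ∀ {P : Pred ℕ 0ℓ} → Decidable P → ∀ xs →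
    (∃[ x ] x ∈ xs × P x × (∀ {z} → z ∈ xs → P z → x ≼ z)) ⊎ (∀ {z} → z ∈ xs → ¬ P z)
  extremum P? [] = inj₂ λ ()
  extremum P? (x ∷ xs) with P? x | extremum P? xs
  ... | no ¬Px | inj₂ none = inj₂ λ { (here refl) → ¬Px ; (there z∈) → none z∈ }
  ... | no ¬Px | inj₁ (y , y∈ , Py , y≼) =
    inj₁ (y , there y∈ , Py , λ { (here refl) Px → contradiction Px ¬Px ; (there z∈) → y≼ z∈ })
  ... | yes Px | inj₂ none =
    inj₁ (x , here refl , Px , λ { (here refl) _ → ≼-refl ; (there z∈) Pz → contradiction Pz (none z∈) })
  ... | yes Px | inj₁ (y , y∈ , Py , y≼) with total x y
  ...   | inj₁ x≼y = inj₁ (x , here refl , Px , λ { (here refl) _ → ≼-refl ; (there z∈) Pz → ≼-trans x≼y (y≼ z∈ Pz) })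
  ...   | inj₂ y≼x = inj₁ (y , there y∈ , Py , λ { (here refl) _ → y≼x ; (there z∈) → y≼ z∈ })

open Extremum _≤_ ℕ.≤-total ℕ.≤-trans using () renaming (extremum to least)
open Extremum (λ x y → y ≤ x) (λ x y → ℕ.≤-total y x) (λ p q → ℕ.≤-trans q p) using () renaming (extremum to greatest)

Consecutive Extreme : List ℕ → ℕ → ℕ → Set
Consecutive vs a b = ∀ {z} → z ∈ vs → z ≤ a ⊎ b ≤ z
Extreme     vs a b = ∀ {z} → z ∈ vs → a ≤ z × z ≤ b

-- Sides, diagonals and cells are described by the vertex set only; this makes
-- sense for the polygon spanned by any set vs of vertices.
record Side (vs : List ℕ) (a b : ℕ) : Set where
  constructor side
  field
    a∈   : a ∈ vs
    b∈   : b ∈ vs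
    a<b  : a < b
    kind : Consecutive vs a b ⊎ Extreme vs a b

side-restrict : ∀ {vs c a b} → c ⊆ vs → a ∈ c → b ∈ c → Side vs a b → Side c a b
side-restrict c⊆ a∈ b∈ (side _ _ a<b (inj₁ con)) = side a∈ b∈ a<b (inj₁ λ z∈ → con (c⊆ z∈))
side-restrict c⊆ a∈ b∈ (side _ _ a<b (inj₂ ext)) = side a∈ b∈ a<b (inj₂ λ z∈ → ext (c⊆ z∈))

record Cell (vs : List ℕ) (ds : List Segment) (c : List ℕ) : Set where
  constructor cell
  field
    sorted   : Sorted c
    c⊆       : c ⊆ vs
    size     : 3 ≤ length c
    bounding : ∀ {x y} → Side c x y → Side vs x y ⊎ (x , y) ∈ ds
    uncut    : ∀ {x y} → x ∈ c → y ∈ c → (x , y) ∈ ds → Side c x y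

¬⊆pair : ∀ {c a b} → Sorted c → 3 ≤ length c → ¬ (∀ {z} → z ∈ c → z ≡ a ⊎ z ≡ b)
¬⊆pair {_ ∷ []} _ (s≤s ())
¬⊆pair {_ ∷ _ ∷ []} _ (s≤s (s≤s ()))
¬⊆pair {x ∷ y ∷ z ∷ _} ((x<y ∷ x<z ∷ _) ∷ (y<z ∷ _) ∷ _) _ ab
  with ab (here refl) | ab (there (here refl)) | ab (there (there (here refl)))
... | inj₁ refl | inj₁ refl | _         = ℕ.<-irrefl refl x<y
... | inj₁ refl | inj₂ refl | inj₁ refl = ℕ.<-irrefl refl x<z
... | inj₁ refl | inj₂ refl | inj₂ refl = ℕ.<-irrefl refl y<z
... | inj₂ refl | inj₂ refl | _         = ℕ.<-irrefl refl x<y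
... | inj₂ refl | inj₁ refl | inj₂ refl = ℕ.<-irrefl refl x<z
... | inj₂ refl | inj₁ refl | inj₁ refl = ℕ.<-irrefl refl y<z

-- Together the two conditions leave room for no vertex but `a` and `b`.
¬consecutive∧extreme : ∀ {c a b} → Sorted c → 3 ≤ length c → Consecutive c a b → ¬ Extreme c a b
¬consecutive∧extreme {c} {a} {b} c↗ size con ext = ¬⊆pair c↗ size ab
  where
  ab : ∀ {z} → z ∈ c → z ≡ a ⊎ z ≡ b
  ab z∈ with con z∈ | ext z∈
  ... | inj₁ z≤a | a≤z , _ = inj₁ (ℕ.≤-antisym z≤a a≤z)
  ... | inj₂ b≤z | _ , z≤b = inj₂ (ℕ.≤-antisym z≤b b≤z)

closingSide : ∀ {c} → Sorted c → 3 ≤ length c → ∃[ a ] ∃[ b ] a ∈ c × b ∈ c × a < b × Extreme c a b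
closingSide {c@(x ∷ _)} c↗ size with least U? c | greatest U? c
... | inj₂ none | _ = contradiction tt (none (here refl))
... | inj₁ _ | inj₂ none = contradiction tt (none (here refl))
... | inj₁ (a , a∈ , _ , a≤) | inj₁ (b , b∈ , _ , ≤b) = a , b , a∈ , b∈ , ℕ.≤∧≢⇒< (proj₁ (ext b∈)) a≢b , ext
  where
  ext : Extreme c a b
  ext z∈ = a≤ z∈ tt , ≤b z∈ tt
  a≢b : a ≢ b
  a≢b refl = ¬⊆pair {b = a} c↗ size λ z∈ → inj₁ (ℕ.≤-antisym (proj₂ (ext z∈)) (proj₁ (ext z∈)))

-- The closing side of `c` can only be the closing side of `vs`, so a vertex `v` missing from `c`
-- has neighbours x < v < y in `c`. The segment from x to y is a side of `c`. As a side of `vs` it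
-- cannot be consecutive, because of `v`, nor extreme, because `c` has a third vertex.
whole-cell : ∀ {vs c} → Sorted vs → Sorted c → c ⊆ vs → 3 ≤ length c →
             (∀ {x y} → Side c x y → Side vs x y) → c ≡ vs
whole-cell {vs} {c} vs↗ c↗ c⊆ size bounding with closingSide c↗ size
... | a , b , a∈ , b∈ , a<b , ext with Side.kind (bounding (side a∈ b∈ a<b (inj₂ ext)))
...   | inj₁ con = ⊥-elim (¬consecutive∧extreme c↗ size (λ z∈ → con (c⊆ z∈)) ext)
...   | inj₂ ext-vs = sorted-ext c↗ vs↗ c⊆ vs⊆
  where
  vs⊆ : vs ⊆ c
  vs⊆ {v} v∈ with greatest (ℕ._≤? v) c | least (v ℕ.≤?_) c
  ... | inj₂ none | _ = contradiction (proj₁ (ext-vs v∈)) (none a∈)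
  ... | _ | inj₂ none = contradiction (proj₂ (ext-vs v∈)) (none b∈)
  ... | inj₁ (x , x∈ , x≤v , ≤x) | inj₁ (y , y∈ , v≤y , y≤) with x ℕ.≟ v | v ℕ.≟ y
  ...   | yes refl | _        = x∈
  ...   | _        | yes refl = y∈
  ...   | no x≢v   | no v≢y   = contradiction (Side.kind (bounding (side x∈ y∈ x<y (inj₁ con)))) λ
    { (inj₁ con-vs) → [ ℕ.<⇒≱ x<v , ℕ.<⇒≱ v<y ]′ (con-vs v∈)
    ; (inj₂ ext-xy) → ¬consecutive∧extreme c↗ size con (λ z∈ → ext-xy (c⊆ z∈)) }
    where
    x<v = ℕ.≤∧≢⇒< x≤v x≢v
    v<y = ℕ.≤∧≢⇒< v≤y v≢y
    x<y = ℕ.<-trans x<v v<y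
    con : Consecutive c x y
    con {z} z∈ with ℕ.≤-total z v
    ... | inj₁ z≤v = inj₁ (≤x z∈ z≤v)
    ... | inj₂ v≤z = inj₂ (y≤ z∈ v≤z)

-- The two halves cut off by a chord

-- Both halves keep the ends of the chord. It is the closing side of `E` but joins neighbours in
-- `V`, and hence the two halves are treated differently below.
record Divides (i j : ℕ) (vs E V : List ℕ) : Set where
  field
    i∈  : i ∈ vs
    j∈  : j ∈ vs
    i<j : i < j
    E⁺  : ∀ {z} → z ∈ vs → i ≤ z → z ≤ j → z ∈ E
    E⁻  : ∀ {z} → z ∈ E → z ∈ vs × i ≤ z × z ≤ j
    V⁺  : ∀ {z} → z ∈ vs → z ≤ i ⊎ j ≤ z → z ∈ V
    V⁻  : ∀ {z} → z ∈ V → z ∈ vs × (z ≤ i ⊎ j ≤ z)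

  i≤j = ℕ.<⇒≤ i<j
  i∈E = E⁺ i∈ ℕ.≤-refl i≤j
  j∈E = E⁺ j∈ i≤j ℕ.≤-refl
  i∈V = V⁺ i∈ (inj₁ ℕ.≤-refl)
  j∈V = V⁺ j∈ (inj₂ ℕ.≤-refl)

  E∩V : ∀ {z} → z ∈ E → z ∈ V → z ≡ i ⊎ z ≡ j
  E∩V z∈E z∈V with E⁻ z∈E | V⁻ z∈V
  ... | _ , i≤z , z≤j | _ , inj₁ z≤i = inj₁ (ℕ.≤-antisym z≤i i≤z)
  ... | _ , i≤z , z≤j | _ , inj₂ j≤z = inj₂ (ℕ.≤-antisym z≤j j≤z)

  E∩V-segment : ∀ {x y} → x ∈ E → y ∈ E → x ∈ V → y ∈ V → x < y → x ≡ i × y ≡ j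
  E∩V-segment x∈E y∈E x∈V y∈V x<y with E∩V x∈E x∈V | E∩V y∈E y∈V
  ... | inj₁ refl | inj₁ refl = contradiction x<y (ℕ.<-irrefl refl)
  ... | inj₁ refl | inj₂ refl = refl , refl
  ... | inj₂ refl | inj₁ refl = contradiction x<y (ℕ.<-asym i<j)
  ... | inj₂ refl | inj₂ refl = contradiction x<y (ℕ.<-irrefl refl)

  side-ij-E : Side E i j
  side-ij-E = side i∈E j∈E i<j (inj₂ λ z∈ → proj₂ (E⁻ z∈))

  side-ij-V : Side V i j
  side-ij-V = side i∈V j∈V i<j (inj₁ λ z∈ → proj₂ (V⁻ z∈))

  side-E : ∀ {x y} → Side E x y → Side vs x y ⊎ (x ≡ i × y ≡ j)
  side-E (side x∈ y∈ x<y (inj₂ ext)) = inj₂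
    ( ℕ.≤-antisym (proj₁ (ext i∈E)) (proj₁ (proj₂ (E⁻ x∈)))
    , ℕ.≤-antisym (proj₂ (proj₂ (E⁻ y∈))) (proj₂ (ext j∈E)) )
  side-E {x} {y} (side x∈ y∈ x<y (inj₁ con)) with E⁻ x∈ | E⁻ y∈
  ... | x∈vs , i≤x , x≤j | y∈vs , i≤y , y≤j = inj₁ (side x∈vs y∈vs x<y (inj₁ con-vs))
    where
    con-vs : Consecutive vs x y
    con-vs {z} z∈ with ℕ.≤-total z i | ℕ.≤-total z j
    ... | inj₁ z≤i | _        = inj₁ (ℕ.≤-trans z≤i i≤x)
    ... | _        | inj₂ j≤z = inj₂ (ℕ.≤-trans y≤j j≤z)
    ... | inj₂ i≤z | inj₁ z≤j = con (E⁺ z∈ i≤z z≤j)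

  side-V : ∀ {x y} → Side V x y → Side vs x y ⊎ (x ≡ i × y ≡ j)
  side-V {x} {y} (side x∈ y∈ x<y (inj₂ ext)) =
    inj₁ (side (proj₁ (V⁻ x∈)) (proj₁ (V⁻ y∈)) x<y (inj₂ ext-vs))
    where
    ext-vs : Extreme vs x y
    ext-vs {z} z∈ with ℕ.≤-total z i | ℕ.≤-total z j
    ... | inj₁ z≤i | _        = ext (V⁺ z∈ (inj₁ z≤i))
    ... | _        | inj₂ j≤z = ext (V⁺ z∈ (inj₂ j≤z))
    ... | inj₂ i≤z | inj₁ z≤j = ℕ.≤-trans (proj₁ (ext i∈V)) i≤z , ℕ.≤-trans z≤j (proj₂ (ext j∈V))
  side-V {x} {y} (side x∈ y∈ x<y (inj₁ con)) with x ℕ.≟ i | y ℕ.≟ j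
  ... | yes refl | yes refl = inj₂ (refl , refl)
  ... | no x≢i   | _        = inj₁ (side (proj₁ (V⁻ x∈)) (proj₁ (V⁻ y∈)) x<y (inj₁ con-vs))
    where
    con-vs : Consecutive vs x y
    con-vs {z} z∈ with ℕ.≤-total z i | ℕ.≤-total z j
    ... | inj₁ z≤i | _        = con (V⁺ z∈ (inj₁ z≤i))
    ... | _        | inj₂ j≤z = con (V⁺ z∈ (inj₂ j≤z))
    ... | inj₂ i≤z | inj₁ z≤j with con i∈V | proj₂ (V⁻ x∈)
    ...   | inj₂ y≤i | _        = inj₂ (ℕ.≤-trans y≤i i≤z)
    ...   | inj₁ i≤x | inj₁ x≤i = contradiction (ℕ.≤-antisym x≤i i≤x) x≢i
    ...   | inj₁ i≤x | inj₂ j≤x = inj₁ (ℕ.≤-trans z≤j j≤x)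
  side-V {x} {y} (side x∈ y∈ x<y (inj₁ con)) | _ | no y≢j =
    inj₁ (side (proj₁ (V⁻ x∈)) (proj₁ (V⁻ y∈)) x<y (inj₁ con-vs))
    where
    con-vs : Consecutive vs x y
    con-vs {z} z∈ with ℕ.≤-total z i | ℕ.≤-total z j
    ... | inj₁ z≤i | _        = con (V⁺ z∈ (inj₁ z≤i))
    ... | _        | inj₂ j≤z = con (V⁺ z∈ (inj₂ j≤z))
    ... | inj₂ i≤z | inj₁ z≤j with con j∈V | proj₂ (V⁻ y∈)
    ...   | inj₁ j≤x | _        = inj₁ (ℕ.≤-trans z≤j j≤x)
    ...   | inj₂ y≤j | inj₂ j≤y = contradiction (ℕ.≤-antisym y≤j j≤y) y≢j
    ...   | inj₂ y≤j | inj₁ y≤i = inj₂ (ℕ.≤-trans y≤i i≤z)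

-- The hypotheses fit two uses: `ds₁` and `ds₂` are filtered out of `ds` when a polygon is cut, and
-- `ds` is assembled from them and the chord when two dissections are glued.
module Glue {i j vs E V ds ds₁ ds₂} (D : Divides i j vs E V)
  (ij∈ : (i , j) ∈ ds) (ds₁⊆ : ds₁ ⊆ ds) (ds₂⊆ : ds₂ ⊆ ds)
  (ds⁻ : ∀ {d} → d ∈ ds → d ≡ (i , j) ⊎ d ∈ ds₁ ⊎ d ∈ ds₂)
  (ds₁-ends : ∀ {x y} → (x , y) ∈ ds₁ → x ∈ E × y ∈ E × x < y)
  (ds₂-ends : ∀ {x y} → (x , y) ∈ ds₂ → x ∈ V × y ∈ V × x < y)
  where

  open Divides D

  In Out : ℕ → Set
  In z  = i < z × z < j
  Out z = z < i ⊎ j < z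

  in⇒∉V : ∀ {z} → In z → z ∉ V
  in⇒∉V (i<z , z<j) z∈V with proj₂ (V⁻ z∈V)
  ... | inj₁ z≤i = ℕ.<⇒≱ i<z z≤i
  ... | inj₂ j≤z = ℕ.<⇒≱ z<j j≤z

  out⇒∉E : ∀ {z} → Out z → z ∉ E
  out⇒∉E (inj₁ z<i) z∈E = ℕ.<⇒≱ z<i (proj₁ (proj₂ (E⁻ z∈E)))
  out⇒∉E (inj₂ j<z) z∈E = ℕ.<⇒≱ j<z (proj₂ (proj₂ (E⁻ z∈E)))

  ends-in-E-or-V : ∀ {x y} → (x , y) ∈ ds → (x ∈ E × y ∈ E) ⊎ (x ∈ V × y ∈ V)
  ends-in-E-or-V d∈ with ds⁻ d∈
  ... | inj₁ refl        = inj₁ (i∈E , j∈E)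
  ... | inj₂ (inj₁ d∈₁)  = inj₁ (proj₁ (ds₁-ends d∈₁) , proj₁ (proj₂ (ds₁-ends d∈₁)))
  ... | inj₂ (inj₂ d∈₂)  = inj₂ (proj₁ (ds₂-ends d∈₂) , proj₁ (proj₂ (ds₂-ends d∈₂)))

  module _ {c} (C : Cell vs ds c) where
    open Cell C

    -- A side of `c` is a side of `vs` or a diagonal, and each of these has both ends in one half.
    no-crossing-side : ∀ {x y} → Side c x y → ¬ (In x × Out y ⊎ Out x × In y)
    no-crossing-side {x} {y} s crossing with bounding s
    ... | inj₁ (side x∈ y∈ x<y (inj₂ ext)) = in-extreme crossing
      where
      in-extreme : ¬ (In x × Out y ⊎ Out x × In y)
      in-extreme (inj₁ ((i<x , _) , _)) = ℕ.<⇒≱ i<x (proj₁ (ext i∈))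
      in-extreme (inj₂ (_ , (_ , y<j))) = ℕ.<⇒≱ y<j (proj₂ (ext j∈))
    ... | inj₁ (side x∈ y∈ x<y (inj₁ con)) = in-consecutive crossing
      where
      in-consecutive : ¬ (In x × Out y ⊎ Out x × In y)
      in-consecutive (inj₁ ((i<x , x<j) , inj₁ y<i)) = ℕ.<-asym x<y (ℕ.<-trans y<i i<x)
      in-consecutive (inj₁ ((i<x , x<j) , inj₂ j<y)) = [ ℕ.<⇒≱ x<j , ℕ.<⇒≱ j<y ]′ (con j∈)
      in-consecutive (inj₂ (inj₁ x<i , (i<y , y<j))) = [ ℕ.<⇒≱ x<i , ℕ.<⇒≱ i<y ]′ (con i∈)
      in-consecutive (inj₂ (inj₂ j<x , (i<y , y<j))) = ℕ.<-asym x<y (ℕ.<-trans y<j j<x)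
    ... | inj₂ d∈ with ends-in-E-or-V d∈ | crossing
    ...   | inj₁ (_ , y∈E) | inj₁ (_ , out) = out⇒∉E out y∈E
    ...   | inj₁ (x∈E , _) | inj₂ (out , _) = out⇒∉E out x∈E
    ...   | inj₂ (x∈V , _) | inj₁ (inn , _) = in⇒∉V inn x∈V
    ...   | inj₂ (_ , y∈V) | inj₂ (_ , inn) = in⇒∉V inn y∈V

    module _ {u z} (u∈ : u ∈ c) (z∈ : z ∈ c) (u-in : In u) (z-out : Out z) where

      -- If `i` were missing, some side of `c` would jump over it, with one end inside and the other
      -- outside: the side from the last vertex before `i` to the first one after it, or the closing
      -- side if no vertex of `c` is at most `i`.
      i∈c : i ∈ c
      i∈c with greatest (ℕ._≤? i) c | least (i ℕ.<?_) c | closingSide sorted size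
      ... | _ | inj₂ none | _ = contradiction (proj₁ u-in) (none u∈)
      ... | inj₂ none | _ | a , b , a∈ , b∈ , a<b , ext = ⊥-elim
        (no-crossing-side (side a∈ b∈ a<b (inj₂ ext))
          (inj₁ ((ℕ.≰⇒> (none a∈) , ℕ.≤-<-trans (proj₁ (ext u∈)) (proj₂ u-in)) , b-out z-out)))
        where
        b-out : Out z → Out b
        b-out (inj₁ z<i) = contradiction (ℕ.<⇒≤ z<i) (none z∈)
        b-out (inj₂ j<z) = inj₂ (ℕ.<-≤-trans j<z (proj₂ (ext z∈)))
      ... | inj₁ (x , x∈ , x≤i , ≤x) | inj₁ (y , y∈ , i<y , y≤) | _ with x ℕ.≟ i
      ...   | yes refl = x∈
      ...   | no x≢i   = ⊥-elim (no-crossing-side (side x∈ y∈ (ℕ.≤-<-trans x≤i i<y) (inj₁ con))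
              (inj₂ (inj₁ (ℕ.≤∧≢⇒< x≤i x≢i) , (i<y , ℕ.≤-<-trans (y≤ u∈ (proj₁ u-in)) (proj₂ u-in)))))
        where
        con : Consecutive c x y
        con {w} w∈ with ℕ.≤-<-connex w i
        ... | inj₁ w≤i = inj₁ (≤x w∈ w≤i)
        ... | inj₂ i<w = inj₂ (y≤ w∈ i<w)

      j∈c : j ∈ c
      j∈c with greatest (ℕ._<? j) c | least (j ℕ.≤?_) c | closingSide sorted size
      ... | inj₂ none | _ | _ = contradiction (proj₂ u-in) (none u∈)
      ... | _ | inj₂ none | a , b , a∈ , b∈ , a<b , ext = ⊥-elim
        (no-crossing-side (side a∈ b∈ a<b (inj₂ ext))
          (inj₂ (a-out z-out , (ℕ.<-≤-trans (proj₁ u-in) (proj₂ (ext u∈)) , ℕ.≰⇒> (none b∈)))))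
        where
        a-out : Out z → Out a
        a-out (inj₁ z<i) = inj₁ (ℕ.≤-<-trans (proj₁ (ext z∈)) z<i)
        a-out (inj₂ j<z) = contradiction (ℕ.<⇒≤ j<z) (none z∈)
      ... | inj₁ (x , x∈ , x<j , ≤x) | inj₁ (y , y∈ , j≤y , y≤) | _ with j ℕ.≟ y
      ...   | yes refl = y∈
      ...   | no j≢y   = ⊥-elim (no-crossing-side (side x∈ y∈ (ℕ.<-≤-trans x<j j≤y) (inj₁ con))
              (inj₁ ((ℕ.<-≤-trans (proj₁ u-in) (≤x u∈ (proj₂ u-in)) , x<j) , inj₂ (ℕ.≤∧≢⇒< j≤y j≢y))))
        where
        con : Consecutive c x y
        con {w} w∈ with ℕ.<-≤-connex w j
        ... | inj₁ w<j = inj₁ (≤x w∈ w<j)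
        ... | inj₂ j≤w = inj₂ (y≤ w∈ j≤w)

      -- With both ends in `c`, the chord must be a side of `c` by `uncut`. But a side has all other
      -- vertices of `c` on one side of it, whereas `u` and `z` lie on different sides.
      not-in-and-out : ⊥
      not-in-and-out with Side.kind (uncut i∈c j∈c ij∈)
      ... | inj₁ con = [ ℕ.<⇒≱ (proj₁ u-in) , ℕ.<⇒≱ (proj₂ u-in) ]′ (con u∈)
      ... | inj₂ ext = [ (λ z<i → ℕ.<⇒≱ z<i (proj₁ (ext z∈))) , (λ j<z → ℕ.<⇒≱ j<z (proj₂ (ext z∈))) ]′ z-out

    ⊆V-of-out : ∀ {z} → z ∈ c → Out z → c ⊆ V
    ⊆V-of-out z∈ z-out {u} u∈ with ℕ.≤-<-connex u i | ℕ.<-≤-connex u j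
    ... | inj₁ u≤i | _        = V⁺ (c⊆ u∈) (inj₁ u≤i)
    ... | _        | inj₂ j≤u = V⁺ (c⊆ u∈) (inj₂ j≤u)
    ... | inj₂ i<u | inj₁ u<j = ⊥-elim (not-in-and-out u∈ z∈ (i<u , u<j) z-out)

    ⊆E-or-⊆V : c ⊆ E ⊎ c ⊆ V
    ⊆E-or-⊆V with least (ℕ._<? i) c | greatest (j ℕ.<?_) c
    ... | inj₁ (z , z∈ , z<i , _) | _ = inj₂ (⊆V-of-out z∈ (inj₁ z<i))
    ... | _ | inj₁ (z , z∈ , j<z , _) = inj₂ (⊆V-of-out z∈ (inj₂ j<z))
    ... | inj₂ none<i | inj₂ none>j =
      inj₁ λ z∈ → E⁺ (c⊆ z∈) (ℕ.≮⇒≥ (none<i z∈)) (ℕ.≮⇒≥ (none>j z∈))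

    cell-E : c ⊆ E → Cell E ds₁ c
    cell-E c⊆E = cell sorted c⊆E size bounding′ λ x∈ y∈ d∈ → uncut x∈ y∈ (ds₁⊆ d∈)
      where
      bounding′ : ∀ {x y} → Side c x y → Side E x y ⊎ (x , y) ∈ ds₁
      bounding′ s@(side x∈ y∈ x<y _) with bounding s
      ... | inj₁ s-vs = inj₁ (side-restrict (λ z∈ → proj₁ (E⁻ z∈)) (c⊆E x∈) (c⊆E y∈) s-vs)
      ... | inj₂ d∈ with ds⁻ d∈
      ...   | inj₁ refl       = inj₁ side-ij-E
      ...   | inj₂ (inj₁ d∈₁) = inj₂ d∈₁
      -- A diagonal of the other half with both ends in `E` can only be the chord.
      ...   | inj₂ (inj₂ d∈₂) with E∩V-segment (c⊆E x∈) (c⊆E y∈) (proj₁ (ds₂-ends d∈₂)) (proj₁ (proj₂ (ds₂-ends d∈₂))) x<y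
      ...     | refl , refl = inj₁ side-ij-E

    cell-V : c ⊆ V → Cell V ds₂ c
    cell-V c⊆V = cell sorted c⊆V size bounding′ λ x∈ y∈ d∈ → uncut x∈ y∈ (ds₂⊆ d∈)
      where
      bounding′ : ∀ {x y} → Side c x y → Side V x y ⊎ (x , y) ∈ ds₂
      bounding′ s@(side x∈ y∈ x<y _) with bounding s
      ... | inj₁ s-vs = inj₁ (side-restrict (λ z∈ → proj₁ (V⁻ z∈)) (c⊆V x∈) (c⊆V y∈) s-vs)
      ... | inj₂ d∈ with ds⁻ d∈
      ...   | inj₁ refl       = inj₁ side-ij-V
      ...   | inj₂ (inj₂ d∈₂) = inj₂ d∈₂
      ...   | inj₂ (inj₁ d∈₁) with E∩V-segment (proj₁ (ds₁-ends d∈₁)) (proj₁ (proj₂ (ds₁-ends d∈₁))) (c⊆V x∈) (c⊆V y∈) x<y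
      ...     | refl , refl = inj₁ side-ij-V

    cell⇒ : Cell E ds₁ c ⊎ Cell V ds₂ c
    cell⇒ with ⊆E-or-⊆V
    ... | inj₁ c⊆E = inj₁ (cell-E c⊆E)
    ... | inj₂ c⊆V = inj₂ (cell-V c⊆V)

  cell-E⇐ : ∀ {c} → Cell E ds₁ c → Cell vs ds c
  cell-E⇐ {c} (cell sorted c⊆E size bounding uncut) =
    cell sorted (λ z∈ → proj₁ (E⁻ (c⊆E z∈))) size bounding′ uncut′
    where
    bounding′ : ∀ {x y} → Side c x y → Side vs x y ⊎ (x , y) ∈ ds
    bounding′ s with bounding s
    ... | inj₂ d∈₁ = inj₂ (ds₁⊆ d∈₁)
    ... | inj₁ s-E with side-E s-E
    ...   | inj₁ s-vs          = inj₁ s-vs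
    ...   | inj₂ (refl , refl) = inj₂ ij∈
    uncut′ : ∀ {x y} → x ∈ c → y ∈ c → (x , y) ∈ ds → Side c x y
    uncut′ x∈ y∈ d∈ with ds⁻ d∈
    ... | inj₁ refl       = side-restrict c⊆E x∈ y∈ side-ij-E
    ... | inj₂ (inj₁ d∈₁) = uncut x∈ y∈ d∈₁
    ... | inj₂ (inj₂ d∈₂) with ds₂-ends d∈₂
    ...   | x∈V , y∈V , x<y with E∩V-segment (c⊆E x∈) (c⊆E y∈) x∈V y∈V x<y
    ...     | refl , refl = side-restrict c⊆E x∈ y∈ side-ij-E

  cell-V⇐ : ∀ {c} → Cell V ds₂ c → Cell vs ds c
  cell-V⇐ {c} (cell sorted c⊆V size bounding uncut) =
    cell sorted (λ z∈ → proj₁ (V⁻ (c⊆V z∈))) size bounding′ uncut′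
    where
    bounding′ : ∀ {x y} → Side c x y → Side vs x y ⊎ (x , y) ∈ ds
    bounding′ s with bounding s
    ... | inj₂ d∈₂ = inj₂ (ds₂⊆ d∈₂)
    ... | inj₁ s-V with side-V s-V
    ...   | inj₁ s-vs          = inj₁ s-vs
    ...   | inj₂ (refl , refl) = inj₂ ij∈
    uncut′ : ∀ {x y} → x ∈ c → y ∈ c → (x , y) ∈ ds → Side c x y
    uncut′ x∈ y∈ d∈ with ds⁻ d∈
    ... | inj₁ refl       = side-restrict c⊆V x∈ y∈ side-ij-V
    ... | inj₂ (inj₂ d∈₂) = uncut x∈ y∈ d∈₂
    ... | inj₂ (inj₁ d∈₁) with ds₁-ends d∈₁
    ...   | x∈E , y∈E , x<y with E∩V-segment x∈E y∈E (c⊆V x∈) (c⊆V y∈) x<y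
    ...     | refl , refl = side-restrict c⊆V x∈ y∈ side-ij-V

-- Sides of a list and sides of a vertex set

IsMaximum : List ℕ → ℕ → Set
IsMaximum vs b = b ∈ vs × (∀ {z} → z ∈ vs → z ≤ b)

IsConsecutive : List ℕ → ℕ → ℕ → Set
IsConsecutive vs a b = a ∈ vs × b ∈ vs × a < b × Consecutive vs a b

-- `v` is independent of the list, because the recursion drops vertices while the closing side keeps
-- its first end.
∈-sidesFrom⁻ : ∀ {v x xs a b} → Sorted (x ∷ xs) → (a , b) ∈ sidesFrom v (x ∷ xs) →
               IsConsecutive (x ∷ xs) a b ⊎ (a ≡ v × IsMaximum (x ∷ xs) b)
∈-sidesFrom⁻ {xs = []} _ (here refl) = inj₂ (refl , here refl , λ { (here refl) → ℕ.≤-refl })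
∈-sidesFrom⁻ {x = x} {y ∷ ys} ((x<y ∷ _) ∷ (y<ys ∷ _)) (here refl) = inj₁ (here refl , there (here refl) , x<y , con)
  where
  con : Consecutive (x ∷ y ∷ ys) x y
  con (here refl)         = inj₁ ℕ.≤-refl
  con (there (here refl)) = inj₂ ℕ.≤-refl
  con (there (there z∈))  = inj₂ (ℕ.<⇒≤ (All.lookup y<ys z∈))
∈-sidesFrom⁻ {xs = y ∷ ys} (x< ∷ ys↗) (there s∈) with ∈-sidesFrom⁻ ys↗ s∈
... | inj₁ (a∈ , b∈ , a<b , con) = inj₁ (there a∈ , there b∈ , a<b , λ
      { (here refl) → inj₁ (ℕ.<⇒≤ (All.lookup x< a∈)) ; (there z∈) → con z∈ })
... | inj₂ (refl , b∈ , max) = inj₂ (refl , there b∈ , λ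
      { (here refl) → ℕ.<⇒≤ (All.lookup x< b∈) ; (there z∈) → max z∈ })

∈-sidesFrom⁺-consecutive : ∀ {v x xs a b} → Sorted (x ∷ xs) → IsConsecutive (x ∷ xs) a b →
                           (a , b) ∈ sidesFrom v (x ∷ xs)
∈-sidesFrom⁺-consecutive {xs = []} _ (here refl , here refl , a<b , _) = contradiction a<b (ℕ.<-irrefl refl)
∈-sidesFrom⁺-consecutive {xs = y ∷ ys} (x< ∷ _) (a∈ , here refl , a<b , _) with a∈
... | here refl = contradiction a<b (ℕ.<-irrefl refl)
... | there a∈′ = contradiction (All.lookup x< a∈′) (ℕ.<-asym a<b)
∈-sidesFrom⁺-consecutive {xs = y ∷ ys} (x< ∷ _) (here refl , there (here refl) , _ , _) = here refl
∈-sidesFrom⁺-consecutive {xs = y ∷ ys} ((x<y ∷ _) ∷ (y<ys ∷ _)) (here refl , there (there b∈) , _ , con) with con (there (here refl))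
... | inj₁ y≤x = contradiction y≤x (ℕ.<⇒≱ x<y)
... | inj₂ b≤y = contradiction b≤y (ℕ.<⇒≱ (All.lookup y<ys b∈))
∈-sidesFrom⁺-consecutive {xs = y ∷ ys} (_ ∷ ys↗) (there a∈ , there b∈ , a<b , con) =
  there (∈-sidesFrom⁺-consecutive ys↗ (a∈ , b∈ , a<b , λ z∈ → con (there z∈)))

∈-sidesFrom⁺-maximum : ∀ {v x xs b} → Sorted (x ∷ xs) → IsMaximum (x ∷ xs) b → (v , b) ∈ sidesFrom v (x ∷ xs)
∈-sidesFrom⁺-maximum {xs = []} _ (here refl , _) = here refl
∈-sidesFrom⁺-maximum {xs = y ∷ ys} ((x<y ∷ _) ∷ _) (here refl , max) = contradiction (max (there (here refl))) (ℕ.<⇒≱ x<y)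
∈-sidesFrom⁺-maximum {xs = y ∷ ys} (_ ∷ ys↗) (there b∈ , max) = there (∈-sidesFrom⁺-maximum ys↗ (b∈ , λ z∈ → max (there z∈)))

-- The bound on the length excludes `sides [ v ]`, which is the degenerate `[ (v , v) ]`.
∈-sides⁻ : ∀ {vs a b} → Sorted vs → 2 ≤ length vs → (a , b) ∈ sides vs → Side vs a b
∈-sides⁻ {x ∷ []} _ (s≤s ()) _
∈-sides⁻ {x ∷ y ∷ ys} vs↗@((x<y ∷ x<) ∷ _) _ s∈ with ∈-sidesFrom⁻ vs↗ s∈
... | inj₁ (a∈ , b∈ , a<b , con) = side a∈ b∈ a<b (inj₁ con)
... | inj₂ (refl , b∈ , max) = side (here refl) b∈ (ℕ.<-≤-trans x<y (max (there (here refl)))) (inj₂ λ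
  { (here refl) → ℕ.≤-refl , max (here refl)
  ; (there z∈)  → ℕ.<⇒≤ (All.lookup (x<y ∷ x<) z∈) , max (there z∈) })

∈-sides⁺ : ∀ {vs a b} → Sorted vs → Side vs a b → (a , b) ∈ sides vs
∈-sides⁺ {x ∷ xs} vs↗ (side a∈ b∈ a<b (inj₁ con)) = ∈-sidesFrom⁺-consecutive vs↗ (a∈ , b∈ , a<b , con)
∈-sides⁺ {x ∷ xs} vs↗@(x< ∷ _) (side a∈ b∈ a<b (inj₂ ext)) with a∈
... | here refl = ∈-sidesFrom⁺-maximum vs↗ (b∈ , λ z∈ → proj₂ (ext z∈))
... | there a∈′ = contradiction (proj₁ (ext (here refl))) (ℕ.<⇒≱ (All.lookup x< a∈′))

upTo-sorted : ∀ N → Sorted (upTo N)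
upTo-sorted N = AllPairs.applyUpTo⁺₁ (λ i → i) N (λ i<j _ → i<j)

subPolygon⇒cell : ∀ {N ds c} → 2 ≤ N → IsSubPolygon N ds c → Cell (upTo N) ds c
subPolygon⇒cell {N} {ds} {c} 2≤N P = cell c↗ (λ z∈ → ∈-upTo⁺ (All.lookup bounded z∈)) atLeast3
  bounding′ (λ x∈ y∈ d∈ → ∈-sides⁻ c↗ 2≤c (uncut x∈ y∈ d∈))
  where
  open IsSubPolygon P
  c↗ : Sorted c
  c↗ = Linked⇒AllPairs ℕ.<-trans increasing
  2≤c = ℕ.≤-trans (s≤s (s≤s z≤n)) atLeast3
  bounding′ : ∀ {x y} → Side c x y → Side (upTo N) x y ⊎ (x , y) ∈ ds
  bounding′ s with All.lookup bounding (∈-sides⁺ c↗ s)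
  ... | inj₁ s∈ = inj₁ (∈-sides⁻ (upTo-sorted N) (subst (2 ≤_) (sym (List.length-upTo N)) 2≤N) s∈)
  ... | inj₂ d∈ = inj₂ d∈

cell⇒subPolygon : ∀ {N ds c} → Cell (upTo N) ds c → IsSubPolygon N ds c
cell⇒subPolygon {N} {ds} {c} C = record
  { increasing = AllPairs⇒Linked sorted
  ; bounded    = All.tabulate (λ z∈ → ∈-upTo⁻ (c⊆ z∈))
  ; atLeast3   = size
  ; bounding   = All.tabulate (λ s∈ → bounding′ (∈-sides⁻ sorted 2≤c s∈))
  ; uncut      = λ x∈ y∈ d∈ → ∈-sides⁺ sorted (uncut x∈ y∈ d∈)
  }
  where
  open Cell C
  2≤c = ℕ.≤-trans (s≤s (s≤s z≤n)) size
  bounding′ : ∀ {x y} → Side c x y → (x , y) ∈ polygonSides N ⊎ (x , y) ∈ ds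
  bounding′ s with bounding s
  ... | inj₁ s-vs = inj₁ (∈-sides⁺ (upTo-sorted N) s-vs)
  ... | inj₂ d∈   = inj₂ d∈

-- Systems of diagonals and their cells

record Diagonals (vs : List ℕ) (ds : List Segment) : Set where
  field
    ends        : ∀ {x y} → (x , y) ∈ ds → x ∈ vs × y ∈ vs × x < y
    notSide     : ∀ {x y} → (x , y) ∈ ds → ¬ Side vs x y
    nonCrossing : ∀ {d e} → d ∈ ds → e ∈ ds → ¬ Cross d e

record Cells (vs : List ℕ) (ds : List Segment) (cs : List (List ℕ)) : Set where
  field
    unique : Unique cs
    cells⁻ : ∀ {c} → c ∈ cs → Cell vs ds c
    cells⁺ : ∀ {c} → Cell vs ds c → c ∈ cs

noDiagonals : ∀ {vs} → Diagonals vs []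
noDiagonals = record { ends = λ () ; notSide = λ () ; nonCrossing = λ () }

singleCell : ∀ {vs} → Sorted vs → 3 ≤ length vs → Cells vs [] [ vs ]
singleCell {vs} vs↗ 3≤ = record
  { unique = [] ∷ []
  ; cells⁻ = λ { (here refl) → cell vs↗ (λ z∈ → z∈) 3≤ inj₁ (λ _ _ ()) }
  ; cells⁺ = λ C → here (only C)
  }
  where
  only : ∀ {c} → Cell vs [] c → c ≡ vs
  only (cell c↗ c⊆ size bounding _) =
    whole-cell vs↗ c↗ c⊆ size λ s → [ (λ s-vs → s-vs) , (λ ()) ]′ (bounding s)

glueCells : ∀ {i j vs E V ds ds₁ ds₂ cs₁ cs₂} → Divides i j vs E V →
  (i , j) ∈ ds → ds₁ ⊆ ds → ds₂ ⊆ ds →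
  (∀ {d} → d ∈ ds → d ≡ (i , j) ⊎ d ∈ ds₁ ⊎ d ∈ ds₂) →
  (∀ {x y} → (x , y) ∈ ds₁ → x ∈ E × y ∈ E × x < y) →
  (∀ {x y} → (x , y) ∈ ds₂ → x ∈ V × y ∈ V × x < y) →
  Cells E ds₁ cs₁ → Cells V ds₂ cs₂ → Cells vs ds (cs₁ ++ cs₂)
glueCells {i} {j} {vs} {ds = ds} {cs₁ = cs₁} {cs₂} D ij∈ ds₁⊆ ds₂⊆ ds⁻ ends₁ ends₂ C₁ C₂ = record
  { unique = Unique.++⁺ (Cells.unique C₁) (Cells.unique C₂) disjoint
  ; cells⁻ = λ c∈ → [ (λ c∈₁ → cell-E⇐ (Cells.cells⁻ C₁ c∈₁)) , (λ c∈₂ → cell-V⇐ (Cells.cells⁻ C₂ c∈₂)) ]′ (∈-++⁻ cs₁ c∈)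
  ; cells⁺ = λ C → [ (λ C → ∈-++⁺ˡ (Cells.cells⁺ C₁ C)) , (λ C → ∈-++⁺ʳ cs₁ (Cells.cells⁺ C₂ C)) ]′ (cell⇒ C)
  }
  where
  open Glue D ij∈ ds₁⊆ ds₂⊆ ds⁻ ends₁ ends₂
  disjoint : ∀ {c} → ¬ (c ∈ cs₁ × c ∈ cs₂)
  disjoint (c∈₁ , c∈₂) with Cells.cells⁻ C₁ c∈₁ | Cells.cells⁻ C₂ c∈₂
  ... | cell c↗ c⊆E size _ _ | cell _ c⊆V _ _ _ = ¬⊆pair c↗ size λ z∈ → Divides.E∩V D (c⊆E z∈) (c⊆V z∈)

sorted-++⁻ : ∀ xs {ys} → Sorted (xs ++ ys) →
             Sorted xs × Sorted ys × (∀ {x y} → x ∈ xs → y ∈ ys → x < y)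
sorted-++⁻ []       ys↗ = [] , ys↗ , λ ()
sorted-++⁻ (x ∷ xs) (x< ∷ xys↗) with sorted-++⁻ xs xys↗
... | xs↗ , ys↗ , xs<ys =
    All.tabulate (λ z∈ → All.lookup x< (∈-++⁺ˡ z∈)) ∷ xs↗ , ys↗
  , λ { (here refl) y∈ → All.lookup x< (∈-++⁺ʳ xs y∈) ; (there x∈) y∈ → xs<ys x∈ y∈ }

sorted-++⁺ : ∀ {xs ys} → Sorted xs → Sorted ys → (∀ {x y} → x ∈ xs → y ∈ ys → x < y) → Sorted (xs ++ ys)
sorted-++⁺ xs↗ ys↗ xs<ys = AllPairs.++⁺ xs↗ ys↗ (All.tabulate λ x∈ → All.tabulate λ y∈ → xs<ys x∈ y∈)

module Divided p i mid j q (vs↗ : Sorted (p ++ i ∷ mid ++ j ∷ q)) where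

  vs E V : List ℕ
  vs = p ++ i ∷ mid ++ j ∷ q
  E  = i ∷ mid ++ [ j ]
  V  = p ++ i ∷ j ∷ q

  private
    r : List ℕ
    r = i ∷ mid ++ j ∷ q
    p↗ = proj₁ (sorted-++⁻ p vs↗)
    r↗ = proj₁ (proj₂ (sorted-++⁻ p vs↗))
    p<r : ∀ {x y} → x ∈ p → y ∈ r → x < y
    p<r = proj₂ (proj₂ (sorted-++⁻ p vs↗))
    mid↗ = proj₁ (sorted-++⁻ (i ∷ mid) r↗)
    jq↗ = proj₁ (proj₂ (sorted-++⁻ (i ∷ mid) r↗))
    mid<jq : ∀ {x y} → x ∈ i ∷ mid → y ∈ j ∷ q → x < y
    mid<jq = proj₂ (proj₂ (sorted-++⁻ (i ∷ mid) r↗))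
    j<q : ∀ {y} → y ∈ q → j < y
    j<q y∈ with jq↗
    ... | j< ∷ _ = All.lookup j< y∈

  p<i : ∀ {z} → z ∈ p → z < i
  p<i z∈ = p<r z∈ (here refl)

  i<mid : ∀ {z} → z ∈ mid → i < z
  i<mid z∈ with mid↗
  ... | i< ∷ _ = All.lookup i< z∈

  mid<j : ∀ {z} → z ∈ mid → z < j
  mid<j z∈ = mid<jq (there z∈) (here refl)

  i<j : i < j
  i<j = mid<jq (here refl) (here refl)

  E-sorted : Sorted E
  E-sorted = sorted-++⁺ mid↗ ([] ∷ []) λ { x∈ (here refl) → mid<jq x∈ (here refl) }

  V-sorted : Sorted V
  V-sorted = sorted-++⁺ p↗ ((i<j ∷ All.tabulate (λ z∈ → ℕ.<-trans i<j (j<q z∈))) ∷ jq↗) λ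
    { x∈ (here refl) → p<i x∈ ; x∈ (there y∈) → p<r x∈ (there (∈-++⁺ʳ mid y∈)) }

  divided : Divides i j vs E V
  divided .Divides.i∈ = ∈-++⁺ʳ p (here refl)
  divided .Divides.j∈ = ∈-++⁺ʳ p (there (∈-++⁺ʳ mid (here refl)))
  divided .Divides.i<j = i<j
  divided .Divides.E⁺ z∈ i≤z z≤j with ∈-++⁻ p z∈
  ... | inj₁ z∈p = contradiction i≤z (ℕ.<⇒≱ (p<i z∈p))
  ... | inj₂ (here refl) = here refl
  ... | inj₂ (there z∈′) with ∈-++⁻ mid z∈′
  ...   | inj₁ z∈mid = there (∈-++⁺ˡ z∈mid)
  ...   | inj₂ (here refl) = there (∈-++⁺ʳ mid (here refl))
  ...   | inj₂ (there z∈q) = contradiction z≤j (ℕ.<⇒≱ (j<q z∈q))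
  divided .Divides.E⁻ (here refl) = divided .Divides.i∈ , ℕ.≤-refl , ℕ.<⇒≤ i<j
  divided .Divides.E⁻ (there z∈) with ∈-++⁻ mid z∈
  ... | inj₁ z∈mid = ∈-++⁺ʳ p (there (∈-++⁺ˡ z∈mid)) , ℕ.<⇒≤ (i<mid z∈mid) , ℕ.<⇒≤ (mid<j z∈mid)
  ... | inj₂ (here refl) = divided .Divides.j∈ , ℕ.<⇒≤ i<j , ℕ.≤-refl
  divided .Divides.V⁺ z∈ out with ∈-++⁻ p z∈
  ... | inj₁ z∈p = ∈-++⁺ˡ z∈p
  ... | inj₂ (here refl) = ∈-++⁺ʳ p (here refl)
  ... | inj₂ (there z∈′) with ∈-++⁻ mid z∈′
  ...   | inj₁ z∈mid = ⊥-elim ([ ℕ.<⇒≱ (i<mid z∈mid) , ℕ.<⇒≱ (mid<j z∈mid) ]′ out)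
  ...   | inj₂ z∈jq  = ∈-++⁺ʳ p (there z∈jq)
  divided .Divides.V⁻ z∈ with ∈-++⁻ p z∈
  ... | inj₁ z∈p = ∈-++⁺ˡ z∈p , inj₁ (ℕ.<⇒≤ (p<i z∈p))
  ... | inj₂ (here refl) = divided .Divides.i∈ , inj₁ ℕ.≤-refl
  ... | inj₂ (there (here refl)) = divided .Divides.j∈ , inj₂ ℕ.≤-refl
  ... | inj₂ (there (there z∈q)) = ∈-++⁺ʳ p (there (∈-++⁺ʳ mid (there z∈q))) , inj₂ (ℕ.<⇒≤ (j<q z∈q))

  p∌E : ∀ {z} → z ∈ p → z ∉ E
  p∌E z∈p z∈E = ℕ.<⇒≱ (p<i z∈p) (proj₁ (proj₂ (divided .Divides.E⁻ z∈E)))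

  q∌E : ∀ {z} → z ∈ q → z ∉ E
  q∌E z∈q z∈E = ℕ.<⇒≱ (j<q z∈q) (proj₂ (proj₂ (divided .Divides.E⁻ z∈E)))

  mid∌V : ∀ {z} → z ∈ mid → z ∉ V
  mid∌V z∈mid z∈V = [ ℕ.<⇒≱ (i<mid z∈mid) , ℕ.<⇒≱ (mid<j z∈mid) ]′ (proj₂ (divided .Divides.V⁻ z∈V))

-- Labels of the vertices

module _ (w : List ℕ → ℤ) where

  sum : List (List ℕ) → ℤ
  sum cs = foldr _+_ 0ℤ (map w cs)

  -- `weightSum` is an instance by definition; `cellCount` is one by `count≡label`, where the
  -- quadrilateral gets weight 0.
  label : List (List ℕ) → ℕ → ℤ
  label cs v = sum (filter (v ∈?_) cs)

  label-∉ : ∀ {v} cs → (∀ {c} → c ∈ cs → v ∉ c) → label cs v ≡ 0ℤ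
  label-∉ {v} cs ∉ = cong sum (List.filter-none (v ∈?_) (All.tabulate ∉))

  label-single : ∀ {v c} → v ∈ c → label [ c ] v ≡ w c
  label-single {v} {c} v∈ = trans (cong sum (List.filter-accept (v ∈?_) v∈)) (ℤ.+-identityʳ (w c))

  label-++ : ∀ cs₁ cs₂ v → label (cs₁ ++ cs₂) v ≡ label cs₁ v + label cs₂ v
  label-++ [] cs₂ v = sym (ℤ.+-identityˡ _)
  label-++ (c ∷ cs₁) cs₂ v with v ∈? c
  ... | yes _ = trans (cong (λ x → w c + x) (label-++ cs₁ cs₂ v)) (sym (ℤ.+-assoc (w c) _ _))
  ... | no  _ = label-++ cs₁ cs₂ v

  labels-single : ∀ c → map (label [ c ]) c ≡ replicate (length c) (w c)
  labels-single c = constant c (λ v∈ → v∈)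
    where
    constant : ∀ vs → vs ⊆ c → map (label [ c ]) vs ≡ replicate (length vs) (w c)
    constant []       _   = refl
    constant (v ∷ vs) vs⊆ = cong₂ _∷_ (label-single (vs⊆ (here refl))) (constant vs (vs⊆ ∘ there))

  labels-glue : ∀ p i mid j q {ds₁ ds₂ cs₁ cs₂} → Sorted (p ++ i ∷ mid ++ j ∷ q) →
    Cells (i ∷ mid ++ [ j ]) ds₁ cs₁ → Cells (p ++ i ∷ j ∷ q) ds₂ cs₂ →
    map (label (cs₁ ++ cs₂)) (p ++ i ∷ mid ++ j ∷ q) ≡
    map (label cs₂) p ++ (label cs₁ i + label cs₂ i) ∷ map (label cs₁) mid ++
    (label cs₁ j + label cs₂ j) ∷ map (label cs₂) q
  labels-glue p i mid j q {cs₁ = cs₁} {cs₂} vs↗ C₁ C₂ =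
    trans (List.map-++ f p _) (cong₂ _++_ (List.map-cong-local (All.tabulate λ z∈ → outside (p∌E z∈)))
    (cong₂ _∷_ (label-++ cs₁ cs₂ i)
    (trans (List.map-++ f mid _) (cong₂ _++_ (List.map-cong-local (All.tabulate λ z∈ → inner (mid∌V z∈)))
    (cong₂ _∷_ (label-++ cs₁ cs₂ j) (List.map-cong-local (All.tabulate λ z∈ → outside (q∌E z∈))))))))
    where
    open Divided p i mid j q vs↗
    f = label (cs₁ ++ cs₂)
    outside : ∀ {v} → v ∉ E → f v ≡ label cs₂ v
    outside {v} v∉E = trans (label-++ cs₁ cs₂ v) (trans
      (cong (_+ label cs₂ v) (label-∉ cs₁ λ c∈ v∈ → v∉E (Cell.c⊆ (Cells.cells⁻ C₁ c∈) v∈)))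
      (ℤ.+-identityˡ _))
    inner : ∀ {v} → v ∉ V → f v ≡ label cs₁ v
    inner {v} v∉V = trans (label-++ cs₁ cs₂ v) (trans
      (cong (λ x → label cs₁ v + x) (label-∉ cs₂ λ c∈ v∈ → v∉V (Cell.c⊆ (Cells.cells⁻ C₂ c∈) v∈)))
      (ℤ.+-identityʳ _))

-- Dissecting along a diagonal

-- These are the words of single cells. The ones that occur are 1 repeated a multiple of 3 times, 0
-- repeated 4 times and -1 repeated 3 times.
TrivialWeights : (List ℕ → ℤ) → List (List ℕ) → Set
TrivialWeights w cs = ∀ {c} → c ∈ cs → replicate (length c) (w c) ≋ []

between : ∀ {i j vs} → Sorted vs → i ∈ vs → j ∈ vs → i < j →
          ∃[ p ] ∃[ mid ] ∃[ q ] vs ≡ p ++ i ∷ mid ++ j ∷ q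
between {i} {j} vs↗ i∈ j∈ i<j with ∈-∃++ i∈
... | p , r , refl with ∈-++⁻ p j∈ | sorted-++⁻ p vs↗
...   | inj₁ j∈p | _ , _ , p<ir = contradiction (p<ir j∈p (here refl)) (ℕ.<-asym i<j)
...   | inj₂ (here refl) | _ = contradiction i<j (ℕ.<-irrefl refl)
...   | inj₂ (there j∈r) | _ with ∈-∃++ j∈r
...     | mid , q , refl = p , mid , q , refl

module Cut {vs ds} (diags : Diagonals vs ds) {i j} (ij∈ : (i , j) ∈ ds)
           {E V} (D : Divides i j vs E V) where
  open Diagonals diags
  open Divides D

  -- The chord is left out, in all its copies: it is a side of both halves and so no longer a
  -- diagonal.
  WithinE WithinV : Segment → Set
  WithinE d@(k , l) = d ≢ (i , j) × i ≤ k × l ≤ j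
  WithinV d@(k , l) = d ≢ (i , j) × (k ≤ i ⊎ j ≤ k) × (l ≤ i ⊎ j ≤ l)

  withinE? : Decidable WithinE
  withinE? d@(k , l) = ¬? (d ≟ˢ (i , j)) ×-dec (i ℕ.≤? k) ×-dec (l ℕ.≤? j)

  withinV? : Decidable WithinV
  withinV? d@(k , l) = ¬? (d ≟ˢ (i , j)) ×-dec ((k ℕ.≤? i) ⊎-dec (j ℕ.≤? k)) ×-dec ((l ℕ.≤? i) ⊎-dec (j ℕ.≤? l))

  ds₁ ds₂ : List Segment
  ds₁ = filter withinE? ds
  ds₂ = filter withinV? ds

  ds₁⊆ : ds₁ ⊆ ds
  ds₁⊆ d∈ = proj₁ (∈-filter⁻ withinE? d∈)

  ds₂⊆ : ds₂ ⊆ ds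
  ds₂⊆ d∈ = proj₁ (∈-filter⁻ withinV? d∈)

  ends₁ : ∀ {x y} → (x , y) ∈ ds₁ → x ∈ E × y ∈ E × x < y
  ends₁ d∈ with ∈-filter⁻ withinE? d∈
  ... | d∈ds , _ , i≤x , y≤j with ends d∈ds
  ...   | x∈ , y∈ , x<y = E⁺ x∈ i≤x (ℕ.≤-trans (ℕ.<⇒≤ x<y) y≤j) , E⁺ y∈ (ℕ.≤-trans i≤x (ℕ.<⇒≤ x<y)) y≤j , x<y

  ends₂ : ∀ {x y} → (x , y) ∈ ds₂ → x ∈ V × y ∈ V × x < y
  ends₂ d∈ with ∈-filter⁻ withinV? d∈
  ... | d∈ds , _ , x-out , y-out with ends d∈ds
  ...   | x∈ , y∈ , x<y = V⁺ x∈ x-out , V⁺ y∈ y-out , x<y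

  -- A diagonal that fits neither half would have one end strictly between `i` and `j` and the other
  -- strictly outside, and so cross the chord.
  ds⁻ : ∀ {d} → d ∈ ds → d ≡ (i , j) ⊎ d ∈ ds₁ ⊎ d ∈ ds₂
  ds⁻ {d@(k , l)} d∈ with d ≟ˢ (i , j)
  ... | yes d≡ = inj₁ d≡
  ... | no d≢ with ℕ.<-≤-connex k i | ℕ.≤-<-connex l j
  ...   | inj₂ i≤k | inj₁ l≤j = inj₂ (inj₁ (∈-filter⁺ withinE? d∈ (d≢ , i≤k , l≤j)))
  ...   | inj₁ k<i | inj₂ j<l = inj₂ (inj₂ (∈-filter⁺ withinV? d∈ (d≢ , inj₁ (ℕ.<⇒≤ k<i) , inj₂ (ℕ.<⇒≤ j<l))))
  ...   | inj₁ k<i | inj₁ l≤j with ℕ.≤-<-connex l i | ℕ.<-≤-connex l j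
  ...     | inj₁ l≤i | _        = inj₂ (inj₂ (∈-filter⁺ withinV? d∈ (d≢ , inj₁ (ℕ.<⇒≤ k<i) , inj₁ l≤i)))
  ...     | inj₂ i<l | inj₁ l<j = contradiction (inj₂ (k<i , i<l , l<j)) (nonCrossing ij∈ d∈)
  ...     | inj₂ i<l | inj₂ j≤l = inj₂ (inj₂ (∈-filter⁺ withinV? d∈ (d≢ , inj₁ (ℕ.<⇒≤ k<i) , inj₂ j≤l)))
  ds⁻ {d@(k , l)} d∈ | no d≢ | inj₂ i≤k | inj₂ j<l with ℕ.≤-<-connex k i | ℕ.<-≤-connex k j
  ...     | inj₁ k≤i | _        = inj₂ (inj₂ (∈-filter⁺ withinV? d∈ (d≢ , inj₁ k≤i , inj₂ (ℕ.<⇒≤ j<l))))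
  ...     | inj₂ i<k | inj₁ k<j = contradiction (inj₁ (i<k , k<j , j<l)) (nonCrossing ij∈ d∈)
  ...     | inj₂ i<k | inj₂ j≤k = inj₂ (inj₂ (∈-filter⁺ withinV? d∈ (d≢ , inj₂ j≤k , inj₂ (ℕ.<⇒≤ j<l))))

  diags₁ : Diagonals E ds₁
  diags₁ = record
    { ends = ends₁
    ; notSide = λ d∈ s → [ notSide (ds₁⊆ d∈) , (λ { (refl , refl) → proj₁ (proj₂ (∈-filter⁻ withinE? {xs = ds} d∈)) refl }) ]′ (side-E s)
    ; nonCrossing = λ d∈ e∈ → nonCrossing (ds₁⊆ d∈) (ds₁⊆ e∈)
    }

  diags₂ : Diagonals V ds₂
  diags₂ = record
    { ends = ends₂
    ; notSide = λ d∈ s → [ notSide (ds₂⊆ d∈) , (λ { (refl , refl) → proj₁ (proj₂ (∈-filter⁻ withinV? {xs = ds} d∈)) refl }) ]′ (side-V s)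
    ; nonCrossing = λ d∈ e∈ → nonCrossing (ds₂⊆ d∈) (ds₂⊆ e∈)
    }

CellsWithTrivialWord : List ℕ → List Segment → Set
CellsWithTrivialWord vs ds =
  ∃[ cs ] Cells vs ds cs × (∀ w → TrivialWeights w cs → map (label w cs) vs ≋ [])

length-∷-∷ʳ : ∀ {A : Set} (x : A) xs y → length (x ∷ xs ++ [ y ]) ≡ 2 ℕ.+ length xs
length-∷-∷ʳ x xs y = cong suc (trans (List.length-++ xs) (ℕ.+-comm (length xs) 1))

module _ (p : List ℕ) (i : ℕ) (mid : List ℕ) (j : ℕ) (q : List ℕ) where

  length-E : length (i ∷ mid ++ [ j ]) ≡ 2 ℕ.+ length mid
  length-E = length-∷-∷ʳ i mid j

  length-V : length (p ++ i ∷ j ∷ q) ≡ 2 ℕ.+ (length p ℕ.+ length q)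
  length-V = trans (List.length-++ p) (trans (ℕ.+-suc (length p) _) (cong suc (ℕ.+-suc (length p) _)))

  length-vs : length (p ++ i ∷ mid ++ j ∷ q) ≡ (length p ℕ.+ length q) ℕ.+ (2 ℕ.+ length mid)
  length-vs = trans (List.length-++ p) (trans (cong (λ n → length p ℕ.+ suc n) (List.length-++ mid))
    (solve (length p) (length mid) (length q)))
    where
    solve : ∀ p m q → p ℕ.+ suc (m ℕ.+ suc q) ≡ (p ℕ.+ q) ℕ.+ (2 ℕ.+ m)
    solve = ℕ.solve-∀

  E<vs : 1 ≤ length p ℕ.+ length q → length (i ∷ mid ++ [ j ]) < length (p ++ i ∷ mid ++ j ∷ q)
  E<vs 1≤ rewrite length-E | length-vs = ℕ.+-monoˡ-≤ (2 ℕ.+ length mid) 1≤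

  V<vs : 1 ≤ length mid → length (p ++ i ∷ j ∷ q) < length (p ++ i ∷ mid ++ j ∷ q)
  V<vs 1≤ rewrite length-V | length-vs | ℕ.+-comm (length p ℕ.+ length q) (2 ℕ.+ length mid) =
    s≤s (s≤s (ℕ.+-monoˡ-≤ (length p ℕ.+ length q) 1≤))

  3≤E : 1 ≤ length mid → 3 ≤ length (i ∷ mid ++ [ j ])
  3≤E 1≤ rewrite length-E = s≤s (s≤s 1≤)

  3≤V : 1 ≤ length p ℕ.+ length q → 3 ≤ length (p ++ i ∷ j ∷ q)
  3≤V 1≤ rewrite length-V = s≤s (s≤s 1≤)

-- With `mid` empty the chord joins neighbours, and with `p` and `q` empty it closes the polygon.
-- Otherwise both halves have at least three vertices, and fewer than the whole.
proper : ∀ p i mid j q → Sorted (p ++ i ∷ mid ++ j ∷ q) → ¬ Side (p ++ i ∷ mid ++ j ∷ q) i j →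
         1 ≤ length mid × 1 ≤ length p ℕ.+ length q
proper p i [] j q vs↗ ¬s = ⊥-elim (¬s (side (Divides.i∈ D) (Divides.j∈ D) (Divides.i<j D)
  (inj₁ λ z∈ → proj₂ (Divides.V⁻ D z∈))))
  where D = Divided.divided p i [] j q vs↗
proper [] i mid j [] vs↗ ¬s = ⊥-elim (¬s (side (Divides.i∈ D) (Divides.j∈ D) (Divides.i<j D)
  (inj₂ λ z∈ → proj₂ (Divides.E⁻ D z∈))))
  where D = Divided.divided [] i mid j [] vs↗
proper []      i (_ ∷ _) j (_ ∷ _) _ _ = s≤s z≤n , s≤s z≤n
proper (_ ∷ _) i (_ ∷ _) j q       _ _ = s≤s z≤n , s≤s z≤n

-- The cells are rebuilt from the diagonals alone, by recursion on the number of vertices. Since the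
-- diagonals determine them up to order, the labels agree with those of any list of cells that a
-- dissection comes with.
dissect : ∀ vs ds → Sorted vs → 3 ≤ length vs → Diagonals vs ds → CellsWithTrivialWord vs ds
dissect vs = go vs (<-wellFounded (length vs))
  where
  go : ∀ vs → Acc _<_ (length vs) → ∀ ds → Sorted vs → 3 ≤ length vs → Diagonals vs ds → CellsWithTrivialWord vs ds
  go vs _ [] vs↗ 3≤ _ = [ vs ] , singleCell vs↗ 3≤ , λ w trivial →
    ≋-trans (≋-reflexive (labels-single w vs)) (trivial (here refl))
  go vs (acc rec) ds@((i , j) ∷ _) vs↗ 3≤ diags with Diagonals.ends diags (here refl)
  ... | i∈ , j∈ , i<j with between vs↗ i∈ j∈ i<j
  ...   | p , mid , q , refl = glued (go E (rec (E<vs p i mid j q 1≤p+q)) ds₁ E-sorted (3≤E p i mid j q 1≤mid) diags₁)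
                                     (go V (rec (V<vs p i mid j q 1≤mid)) ds₂ V-sorted (3≤V p i mid j q 1≤p+q) diags₂)
    where
    open Divided p i mid j q vs↗ using (E; V; E-sorted; V-sorted; divided)
    open Cut diags (here refl) divided
    1≤mid = proj₁ (proper p i mid j q vs↗ (Diagonals.notSide diags (here refl)))
    1≤p+q = proj₂ (proper p i mid j q vs↗ (Diagonals.notSide diags (here refl)))
    glued : CellsWithTrivialWord E ds₁ → CellsWithTrivialWord V ds₂ → CellsWithTrivialWord vs ds
    glued (cs₁ , C₁ , word₁) (cs₂ , C₂ , word₂) = cs₁ ++ cs₂
      , glueCells divided (here refl) ds₁⊆ ds₂⊆ ds⁻ ends₁ ends₂ C₁ C₂ , word
      where
      word : ∀ w → TrivialWeights w (cs₁ ++ cs₂) → map (label w (cs₁ ++ cs₂)) vs ≋ []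
      word w trivial = ≋-trans (≋-reflexive (labels-glue w p i mid j q vs↗ C₁ C₂))
        (≋-trans (glue≋ (map f₂ p) (f₁ i) (f₂ i) (map f₁ mid) (f₁ j) (f₂ j) (map f₂ q)
          (≋-trans (≋-reflexive (cong (f₁ i ∷_) (sym (List.map-++ f₁ mid [ j ])))) (word₁ w (trivial ∘ ∈-++⁺ˡ))))
        (≋-trans (≋-reflexive (sym (List.map-++ f₂ p (i ∷ j ∷ q)))) (word₂ w (trivial ∘ ∈-++⁺ʳ cs₁))))
        where
        f₁ f₂ : ℕ → ℤ
        f₁ = label w cs₁
        f₂ = label w cs₂

-- Building dissections with given labels

glueDiagonals : ∀ p i mid j q {ds₁ ds₂} → Sorted (p ++ i ∷ mid ++ j ∷ q) →
  1 ≤ length mid → 1 ≤ length p ℕ.+ length q →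
  Diagonals (i ∷ mid ++ [ j ]) ds₁ → Diagonals (p ++ i ∷ j ∷ q) ds₂ →
  Diagonals (p ++ i ∷ mid ++ j ∷ q) ((i , j) ∷ ds₁ ++ ds₂)
glueDiagonals p i mid j q {ds₁} {ds₂} vs↗ 1≤mid 1≤p+q D₁ D₂ = record
  { ends = λ d∈ → ends′ (kind d∈)
  ; notSide = λ d∈ → notSide′ (kind d∈)
  ; nonCrossing = λ d∈ e∈ → nonCrossing′ (kind d∈) (kind e∈)
  }
  where
  open Divided p i mid j q vs↗ using (vs; E; V; E-sorted; V-sorted; divided)
  open Divides divided
  module D₁ = Diagonals D₁
  module D₂ = Diagonals D₂

  Kind : Segment → Set
  Kind d = d ≡ (i , j) ⊎ d ∈ ds₁ ⊎ d ∈ ds₂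

  kind : ∀ {d} → d ∈ (i , j) ∷ ds₁ ++ ds₂ → Kind d
  kind (here d≡)  = inj₁ d≡
  kind (there d∈) = inj₂ (∈-++⁻ ds₁ d∈)

  ends′ : ∀ {x y} → Kind (x , y) → x ∈ vs × y ∈ vs × x < y
  ends′ (inj₁ refl) = i∈ , j∈ , i<j
  ends′ (inj₂ (inj₁ d∈)) with D₁.ends d∈
  ... | x∈ , y∈ , x<y = proj₁ (E⁻ x∈) , proj₁ (E⁻ y∈) , x<y
  ends′ (inj₂ (inj₂ d∈)) with D₂.ends d∈
  ... | x∈ , y∈ , x<y = proj₁ (V⁻ x∈) , proj₁ (V⁻ y∈) , x<y

  -- The chord closes `E` and joins neighbours in `V`. If it were a side of `vs`, it would be of
  -- both kinds in one of the two halves.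
  ij-notSide : ¬ Side vs i j
  ij-notSide (side _ _ _ (inj₁ con)) = ¬consecutive∧extreme E-sorted (3≤E p i mid j q 1≤mid)
    (λ z∈ → con (proj₁ (E⁻ z∈))) (λ z∈ → proj₂ (E⁻ z∈))
  ij-notSide (side _ _ _ (inj₂ ext)) = ¬consecutive∧extreme V-sorted (3≤V p i mid j q 1≤p+q)
    (λ z∈ → proj₂ (V⁻ z∈)) (λ z∈ → ext (proj₁ (V⁻ z∈)))

  notSide′ : ∀ {x y} → Kind (x , y) → ¬ Side vs x y
  notSide′ (inj₁ refl) = ij-notSide
  notSide′ (inj₂ (inj₁ d∈)) s with D₁.ends d∈
  ... | x∈ , y∈ , _ = D₁.notSide d∈ (side-restrict (λ z∈ → proj₁ (E⁻ z∈)) x∈ y∈ s)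
  notSide′ (inj₂ (inj₂ d∈)) s with D₂.ends d∈
  ... | x∈ , y∈ , _ = D₂.notSide d∈ (side-restrict (λ z∈ → proj₁ (V⁻ z∈)) x∈ y∈ s)

  V-not-between-E : ∀ {a b v} → a ∈ E → b ∈ E → v ∈ V → ¬ (a < v × v < b)
  V-not-between-E a∈ b∈ v∈ (a<v , v<b) with E⁻ a∈ | E⁻ b∈ | V⁻ v∈
  ... | _ , i≤a , _ | _ | _ , inj₁ v≤i = ℕ.<⇒≱ a<v (ℕ.≤-trans v≤i i≤a)
  ... | _ | _ , _ , b≤j | _ , inj₂ j≤v = ℕ.<⇒≱ v<b (ℕ.≤-trans b≤j j≤v)

  E×V : ∀ {a b k l} → a ∈ E → b ∈ E → k ∈ V → l ∈ V → ¬ Cross (a , b) (k , l)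
  E×V a∈ b∈ k∈ l∈ (inj₁ (a<k , k<b , _)) = V-not-between-E a∈ b∈ k∈ (a<k , k<b)
  E×V a∈ b∈ k∈ l∈ (inj₂ (_ , a<l , l<b)) = V-not-between-E a∈ b∈ l∈ (a<l , l<b)

  V×E : ∀ {a b k l} → a ∈ E → b ∈ E → k ∈ V → l ∈ V → ¬ Cross (k , l) (a , b)
  V×E a∈ b∈ k∈ l∈ (inj₁ (_ , a<l , l<b)) = V-not-between-E a∈ b∈ l∈ (a<l , l<b)
  V×E a∈ b∈ k∈ l∈ (inj₂ (a<k , k<b , _)) = V-not-between-E a∈ b∈ k∈ (a<k , k<b)

  nonCrossing′ : ∀ {d e} → Kind d → Kind e → ¬ Cross d e
  nonCrossing′ (inj₁ refl) (inj₁ refl) = E×V i∈E j∈E i∈V j∈V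
  nonCrossing′ (inj₁ refl) (inj₂ (inj₁ e∈)) with D₁.ends e∈
  ... | a∈ , b∈ , _ = V×E a∈ b∈ i∈V j∈V
  nonCrossing′ (inj₁ refl) (inj₂ (inj₂ e∈)) with D₂.ends e∈
  ... | k∈ , l∈ , _ = E×V i∈E j∈E k∈ l∈
  nonCrossing′ (inj₂ (inj₁ d∈)) (inj₁ refl) with D₁.ends d∈
  ... | a∈ , b∈ , _ = E×V a∈ b∈ i∈V j∈V
  nonCrossing′ (inj₂ (inj₂ d∈)) (inj₁ refl) with D₂.ends d∈
  ... | k∈ , l∈ , _ = V×E i∈E j∈E k∈ l∈
  nonCrossing′ (inj₂ (inj₁ d∈)) (inj₂ (inj₁ e∈)) = D₁.nonCrossing d∈ e∈
  nonCrossing′ (inj₂ (inj₂ d∈)) (inj₂ (inj₂ e∈)) = D₂.nonCrossing d∈ e∈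
  nonCrossing′ (inj₂ (inj₁ d∈)) (inj₂ (inj₂ e∈)) with D₁.ends d∈ | D₂.ends e∈
  ... | a∈ , b∈ , _ | k∈ , l∈ , _ = E×V a∈ b∈ k∈ l∈
  nonCrossing′ (inj₂ (inj₂ d∈)) (inj₂ (inj₁ e∈)) with D₂.ends d∈ | D₁.ends e∈
  ... | k∈ , l∈ , _ | a∈ , b∈ , _ = V×E a∈ b∈ k∈ l∈

Dissects : List ℕ → List Segment → List (List ℕ) → Set
Dissects vs ds cs = Diagonals vs ds × Cells vs ds cs

glueDissections : ∀ p i mid j q {ds₁ ds₂ cs₁ cs₂} → Sorted (p ++ i ∷ mid ++ j ∷ q) →
  1 ≤ length mid → 1 ≤ length p ℕ.+ length q →
  Dissects (i ∷ mid ++ [ j ]) ds₁ cs₁ → Dissects (p ++ i ∷ j ∷ q) ds₂ cs₂ →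
  Dissects (p ++ i ∷ mid ++ j ∷ q) ((i , j) ∷ ds₁ ++ ds₂) (cs₁ ++ cs₂)
glueDissections p i mid j q {ds₁} {ds₂} vs↗ 1≤mid 1≤p+q (D₁ , C₁) (D₂ , C₂) =
    glueDiagonals p i mid j q vs↗ 1≤mid 1≤p+q D₁ D₂
  , glueCells (Divided.divided p i mid j q vs↗) (here refl) (there ∘ ∈-++⁺ˡ) (there ∘ ∈-++⁺ʳ ds₁)
      (λ { (here d≡) → inj₁ d≡ ; (there d∈) → inj₂ (∈-++⁻ ds₁ d∈) })
      (Diagonals.ends D₁) (Diagonals.ends D₂) C₁ C₂

singleDissection : ∀ {vs} → Sorted vs → 3 ≤ length vs → Dissects vs [] [ vs ]
singleDissection vs↗ 3≤ = noDiagonals , singleCell vs↗ 3≤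

-- The restriction to cells inside `vs` makes room for the capping triangle, whose length is
-- divisible by 3 although its weight is -1; its vertex `0` keeps it out of `vs`.
OneOn3∣ : (List ℕ → ℤ) → List ℕ → Set
OneOn3∣ w vs = ∀ {c} → c ⊆ vs → 3 ∣ length c → w c ≡ 1ℤ

record Realization (vs : List ℕ) (l : List ℤ) : Set where
  constructor realization
  field
    {ds}     : List Segment
    {cs}     : List (List ℕ)
    dissects : Dissects vs ds cs
    3∣cells  : ∀ {c} → c ∈ cs → 3 ∣ length c
    labels   : ∀ {w} → OneOn3∣ w vs → map (label w cs) vs ≡ l

splitLength : ∀ {A B : Set} (as : List A) {bs} (vs : List B) → length vs ≡ length (as ++ bs) →
              ∃[ us ] ∃[ ws ] vs ≡ us ++ ws × length us ≡ length as × length ws ≡ length bs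
splitLength []       vs       eq = [] , vs , refl , refl , eq
splitLength (_ ∷ as) (v ∷ vs) eq with splitLength as vs (ℕ.suc-injective eq)
... | us , ws , refl , eq₁ , eq₂ = v ∷ us , ws , refl , cong suc eq₁ , eq₂

++-injective : ∀ {A : Set} (as bs : List A) {cs ds} → length as ≡ length bs →
               as ++ cs ≡ bs ++ ds → as ≡ bs × cs ≡ ds
++-injective []       []       _  eq = refl , eq
++-injective (a ∷ as) (b ∷ bs) eq eq′ with List.∷-injective eq′
... | refl , eq″ with ++-injective as bs (ℕ.suc-injective eq) eq″
...   | refl , eq‴ = refl , eq‴

gluedLabels : ∀ w p i mid j q P {x} x′ {X y} y′ R {ds₁ ds₂ cs₁ cs₂} →
  Sorted (p ++ i ∷ mid ++ j ∷ q) →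
  Cells (i ∷ mid ++ [ j ]) ds₁ cs₁ → Cells (p ++ i ∷ j ∷ q) ds₂ cs₂ →
  length p ≡ length P → length mid ≡ length X →
  map (label w cs₁) (i ∷ mid ++ [ j ]) ≡ x ∷ X ++ [ y ] →
  map (label w cs₂) (p ++ i ∷ j ∷ q) ≡ P ++ x′ ∷ y′ ∷ R →
  map (label w (cs₁ ++ cs₂)) (p ++ i ∷ mid ++ j ∷ q) ≡ P ++ (x + x′) ∷ X ++ (y + y′) ∷ R
gluedLabels w p i mid j q P {x} x′ {X} {y} y′ R {cs₁ = cs₁} {cs₂} vs↗ C₁ C₂ lenP lenX eqE eqV
  with ++-injective (map (label w cs₂) p) P (trans (List.length-map _ p) lenP)
         (trans (sym (List.map-++ _ p (i ∷ j ∷ q))) eqV)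
     | List.∷-injective eqE
... | eqP , eqR | eqx , eqXy
  with ++-injective (map (label w cs₁) mid) X (trans (List.length-map _ mid) lenX)
         (trans (sym (List.map-++ _ mid [ j ])) eqXy)
     | List.∷-injective eqR
... | eqX , eqy | eqx′ , eqR′ with List.∷-injective eqR′
... | eqy′ , eqR″ = trans (labels-glue w p i mid j q vs↗ C₁ C₂)
  (cong₂ _++_ eqP (cong₂ _∷_ (cong₂ _+_ eqx eqx′)
    (cong₂ _++_ eqX (cong₂ _∷_ (cong₂ _+_ (List.∷-injectiveˡ eqy) eqy′) eqR″))))

-- `vs` is any increasing list of the right length, because the result becomes part of a larger
-- polygon and because the recursion removes the inner vertices of an ear.
realize : ∀ {l vs} → Quiddity l → Sorted vs → length vs ≡ length l → Realization vs l
realize {vs = vs} (polygon t) vs↗ len = realization (singleDissection vs↗ 3≤)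
  (λ { (here refl) → 3∣ })
  (λ {w} w≡1 → trans (labels-single w vs) (cong₂ replicate vs-length (w≡1 (λ z∈ → z∈) 3∣)))
  where
  vs-length : length vs ≡ suc t ℕ.* 3
  vs-length = trans len (List.length-replicate (suc t ℕ.* 3))
  3∣ : 3 ∣ length vs
  3∣ = divides (suc t) vs-length
  3≤ : 3 ≤ length vs
  3≤ = subst (3 ≤_) (sym vs-length) (s≤s (s≤s (s≤s z≤n)))
realize {vs = us} (glueEar P x t y R quid) vs↗ len with splitLength P us len
... | p , i ∷ r , refl , lenP , lenR with splitLength (ones (1 ℕ.+ t ℕ.* 3)) r (ℕ.suc-injective lenR)
...   | mid , j ∷ q , refl , lenMid , lenQ =
  glued (realize quid V-sorted lenV)
  where
  open Divided p i mid j q vs↗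
  midLength : length mid ≡ 1 ℕ.+ t ℕ.* 3
  midLength = trans lenMid (List.length-replicate (1 ℕ.+ t ℕ.* 3))
  1≤mid : 1 ≤ length mid
  1≤mid = subst (1 ≤_) (sym midLength) (s≤s z≤n)
  lenV : length V ≡ length (P ++ x ∷ y ∷ R)
  lenV = trans (List.length-++ p) (trans (cong₂ (λ m n → m ℕ.+ suc n) lenP lenQ) (sym (List.length-++ P)))
  1≤p+q : 1 ≤ length p ℕ.+ length q
  1≤p+q = ℕ.≤-pred (ℕ.≤-pred (subst (3 ≤_) (trans (sym lenV) (length-V p i mid j q)) (quiddity-length quid)))
  3∣E : 3 ∣ length E
  3∣E = divides (suc t) (trans (length-E p i mid j q) (cong (2 ℕ.+_) midLength))
  glued : Realization V (P ++ x ∷ y ∷ R) → Realization vs (P ++ (1ℤ + x) ∷ ones (1 ℕ.+ t ℕ.* 3) ++ (1ℤ + y) ∷ R)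
  glued (realization {ds} {cs} D 3∣cells labels) = realization
    (glueDissections p i mid j q vs↗ 1≤mid 1≤p+q D-E D)
    (λ { (here refl) → 3∣E ; (there c∈) → 3∣cells c∈ })
    λ {w} w≡1 → labels′ w w≡1
    where
    D-E = singleDissection E-sorted (3≤E p i mid j q 1≤mid)
    labels′ : ∀ w → OneOn3∣ w vs → map (label w (E ∷ cs)) vs ≡ _
    labels′ w w≡1 = gluedLabels w p i mid j q P x y R vs↗ (proj₂ D-E) (proj₂ D) lenP lenMid
      (trans (labels-single w E)
        (trans (cong₂ replicate (trans (length-E p i mid j q) (cong (2 ℕ.+_) midLength))
                                (w≡1 (λ z∈ → proj₁ (Divides.E⁻ divided z∈)) 3∣E))
               (cong (1ℤ ∷_) (sym (ones-∷ʳ (1 ℕ.+ t ℕ.* 3))))))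
      (labels λ c⊆ → w≡1 (λ z∈ → proj₁ (Divides.V⁻ divided (c⊆ z∈))))

-- From dissections to matrices

M-toList : ∀ {n} (a : Vec ℤ n) → M a ≡ ⟦ toList a ⟧
M-toList []      = refl
M-toList (x ∷ a) = cong (_⊗ mat x -1ℤ 1ℤ 0ℤ) (M-toList a)

≋⇒isPlusMinusT : ∀ {n} (a : Vec ℤ n) → toList a ≋ 0ℤ ∷ 1ℤ ∷ [] → IsPlusMinusT (M a)
≋⇒isPlusMinusT a (word≈ eq) rewrite M-toList a = ≈-trans eq (inj₂ refl)

isPlusMinusT⇒≋ : ∀ {n} (a : Vec ℤ n) → IsPlusMinusT (M a) → toList a ≋ 0ℤ ∷ 1ℤ ∷ []
isPlusMinusT⇒≋ a eq rewrite M-toList a = word≈ (≈-trans eq (inj₂ refl))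

module _ (w : List ℕ → ℤ) where

  sum-↭ : ∀ {cs cs′} → cs ↭ cs′ → sum w cs ≡ sum w cs′
  sum-↭ Perm.refl = refl
  sum-↭ (prep c p) = cong (λ x → w c + x) (sum-↭ p)
  sum-↭ {c ∷ c′ ∷ cs} (swap _ _ p) = trans (cong (λ x → w c + (w c′ + x)) (sum-↭ p))
    (trans (sym (ℤ.+-assoc (w c) (w c′) _)) (trans (cong (λ x → x + _) (ℤ.+-comm (w c) (w c′))) (ℤ.+-assoc (w c′) (w c) _)))
  sum-↭ (Perm.trans p q) = trans (sum-↭ p) (sum-↭ q)

  label-∷-∈ : ∀ {v c} cs → v ∈ c → label w (c ∷ cs) v ≡ w c + label w cs v
  label-∷-∈ {v} cs v∈ = cong (sum w) (List.filter-accept (v ∈?_) v∈)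

  label-∷-∉ : ∀ {v c} cs → v ∉ c → label w (c ∷ cs) v ≡ label w cs v
  label-∷-∉ {v} cs v∉ = cong (sum w) (List.filter-reject (v ∈?_) v∉)

  label-zero : ∀ {v} cs → (∀ {c} → c ∈ cs → v ∈ c → w c ≡ 0ℤ) → label w cs v ≡ 0ℤ
  label-zero [] _ = refl
  label-zero {v} (c ∷ cs) w≡0 with v ∈? c
  ... | yes v∈ = cong₂ _+_ (w≡0 (here refl) v∈) (label-zero cs (w≡0 ∘ there))
  ... | no v∉  = label-zero cs (w≡0 ∘ there)

  -- Lists without repetition and with the same members are permutations of each other, so the sum
  -- over the cells at `v` may be taken over any enumeration `cs′` of them.
  label-unique : ∀ {v cs cs′} → Unique cs → Unique cs′ →
                 (∀ {c} → c ∈ cs → v ∈ c → c ∈ cs′) → (∀ {c} → c ∈ cs′ → c ∈ cs × v ∈ c) →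
                 label w cs v ≡ sum w cs′
  label-unique {v} {cs} {cs′} cs! cs′! to from = sum-↭ (∼bag⇒↭ (unique∧set⇒bag
    (Unique.filter⁺ (v ∈?_) cs!) cs′! (mk⇔
      (λ c∈ → let c∈cs , v∈c = ∈-filter⁻ (v ∈?_) {xs = cs} c∈ in to c∈cs v∈c)
      (λ c∈ → ∈-filter⁺ (v ∈?_) (proj₁ (from c∈)) (proj₂ (from c∈))))))

  label-set : ∀ {cs cs′} → Unique cs → Unique cs′ → cs ⊆ cs′ → cs′ ⊆ cs → ∀ v → label w cs v ≡ label w cs′ v
  label-set {cs} {cs′} cs! cs′! ⊆₁ ⊆₂ v = label-unique cs! (Unique.filter⁺ (v ∈?_) cs′!)
    (λ c∈ v∈ → ∈-filter⁺ (v ∈?_) (⊆₁ c∈) v∈)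
    (λ c∈ → let c∈cs′ , v∈c = ∈-filter⁻ (v ∈?_) {xs = cs′} c∈ in ⊆₂ c∈cs′ , v∈c)

module _ {N} (2≤N : 2 ≤ N) (D : Dissection N) where
  open Dissection D

  cell⁻ : ∀ {c} → c ∈ cells → Cell (upTo N) diagonals c
  cell⁻ c∈ = subPolygon⇒cell 2≤N (Equivalence.to (cells⇔subPolygon _) c∈)

  cell⁺ : ∀ {c} → Cell (upTo N) diagonals c → c ∈ cells
  cell⁺ C = Equivalence.from (cells⇔subPolygon _) (cell⇒subPolygon C)

  diagonals-upTo : Diagonals (upTo N) diagonals
  diagonals-upTo = record
    { ends = λ d∈ → let x<y , y<N , _ = All.lookup areDiagonals d∈ in
        ∈-upTo⁺ (ℕ.<-trans x<y y<N) , ∈-upTo⁺ y<N , x<y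
    ; notSide = λ d∈ s → proj₂ (proj₂ (All.lookup areDiagonals d∈)) (∈-sides⁺ (upTo-sorted N) s)
    ; nonCrossing = nonCrossing
    }

dissection-word : ∀ {N} → 3 ≤ N → (D : Dissection N) → ∀ w → TrivialWeights w (Dissection.cells D) →
                  map (label w (Dissection.cells D)) (upTo N) ≋ []
dissection-word {N} 3≤N D w trivial with dissect (upTo N) (Dissection.diagonals D) (upTo-sorted N)
    (subst (3 ≤_) (sym (List.length-upTo N)) 3≤N) (diagonals-upTo (ℕ.≤-trans (s≤s (s≤s z≤n)) 3≤N) D)
... | cs , C , word = ≋-trans
  (≋-reflexive (List.map-cong (label-set w (Dissection.cellsUnique D) (Cells.unique C)
    (Cells.cells⁺ C ∘ cell⁻ 2≤N D) (cell⁺ 2≤N D ∘ Cells.cells⁻ C)) (upTo N)))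
  (word w (trivial ∘ cell⁺ 2≤N D ∘ Cells.cells⁻ C))
  where
  2≤N : 2 ≤ N
  2≤N = ℕ.≤-trans (s≤s (s≤s z≤n)) 3≤N

toList-tabulate : ∀ (f : ℕ → ℤ) h n → toList (tabulate {n = n} (λ i → f (h (toℕ i)))) ≡ map f (applyUpTo h n)
toList-tabulate f h zero    = refl
toList-tabulate f h (suc n) = cong (f (h 0) ∷_) (toList-tabulate f (h ∘ suc) n)

⊆-beside-diagonal : ∀ {vs ds c i j} → Sorted vs → Diagonals vs ds → (i , j) ∈ ds → Cell vs ds c →
  ∀ {z} → z ∈ c → z < i ⊎ j < z → ∀ {u} → u ∈ c → u ≤ i ⊎ j ≤ u
⊆-beside-diagonal {i = i} {j} vs↗ diags ij∈ C z∈ out u∈ with Diagonals.ends diags ij∈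
... | i∈ , j∈ , i<j with between vs↗ i∈ j∈ i<j
...   | p , mid , q , refl = proj₂ (Divides.V⁻ divided (Glue.⊆V-of-out divided ij∈ ds₁⊆ ds₂⊆ ds⁻ ends₁ ends₂ C z∈ out u∈))
  where
  open Divided p i mid j q vs↗ using (divided)
  open Cut diags ij∈ divided

-- Two of the sides of quad contain the vertex 0 and lie on the polygon; the
-- other two are diagonals that separate quad from the remaining cells.
record Corner {m} (D : NotchedDissection m) : Set where
  constructor corner
  open NotchedDissection D
  field
    {b c d} : ℕ
    quad≡ : quad ≡ 0 ∷ b ∷ c ∷ d ∷ []
    0b∈   : (0 , b) ∈ polygonSides (suc m)
    0d∈   : (0 , d) ∈ polygonSides (suc m)
    bc∉   : (b , c) ∉ polygonSides (suc m)
    cd∉   : (c , d) ∉ polygonSides (suc m)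

-- Let a be the smallest vertex of the quadrilateral. The sides (b , c) and (c , d) avoid `0`, as
-- their ends exceed a, and so do not lie on the polygon. The two that do are (a , b) and (a , d);
-- since `0` is an end of (a , b) and differs from b, it is a.
quad-corner : ∀ {m} (D : NotchedDissection m) → Sorted (NotchedDissection.quad D) → Corner D
quad-corner {m} D = go quad refl quad-length twoSides commonVertex
  where
  open NotchedDissection D
  S = polygonSides (suc m)
  go : ∀ v → quad ≡ v → length v ≡ 4 → length (sidesOnPolygon (suc m) v) ≡ 2 →
       Allᴸ (0 endpointOf_) (sidesOnPolygon (suc m) v) → Sorted v → Corner D
  go (a ∷ b ∷ c ∷ d ∷ []) quad≡ refl two common ((a<b ∷ a<c ∷ a<d ∷ []) ∷ (b<c ∷ b<d ∷ []) ∷ (c<d ∷ []) ∷ [] ∷ []) =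
    pick ((a , b) ∈ˢ? S) ((a , d) ∈ˢ? S)
    where
    ≢0 : ∀ {x} → a < x → 0 ≢ x
    ≢0 a<x refl = contradiction a<x λ ()
    bc∉ : (b , c) ∉ S
    bc∉ s∈ = [ ≢0 a<b , ≢0 a<c ]′ (All.lookup common (∈-filter⁺ (_∈ˢ? S) (there (here refl)) s∈))
    cd∉ : (c , d) ∉ S
    cd∉ s∈ = [ ≢0 a<c , ≢0 a<d ]′ (All.lookup common (∈-filter⁺ (_∈ˢ? S) (there (there (here refl))) s∈))
    reduced : filter (_∈ˢ? S) (sides (a ∷ b ∷ c ∷ d ∷ [])) ≡ filter (_∈ˢ? S) ((a , b) ∷ (a , d) ∷ [])
    reduced = trans (List.filter-++ (_∈ˢ? S) [ (a , b) ] ((b , c) ∷ (c , d) ∷ (a , d) ∷ []))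
      (trans (cong (filter (_∈ˢ? S) [ (a , b) ] ++_)
        (trans (List.filter-reject (_∈ˢ? S) bc∉) (List.filter-reject (_∈ˢ? S) cd∉)))
        (sym (List.filter-++ (_∈ˢ? S) [ (a , b) ] [ (a , d) ])))
    two′ : length (filter (_∈ˢ? S) ((a , b) ∷ (a , d) ∷ [])) ≡ 2
    two′ = trans (cong length (sym reduced)) two
    pick : Dec ((a , b) ∈ S) → Dec ((a , d) ∈ S) → Corner D
    pick (no ab∉) _ = contradiction (trans (sym (cong length (List.filter-reject (_∈ˢ? S) {xs = [ (a , d) ]} ab∉))) two′)
      λ eq → contradiction (subst (_≤ 1) eq (List.length-filter (_∈ˢ? S) [ (a , d) ])) λ { (s≤s ()) }
    pick (yes ab∈) (no ad∉) = contradiction (trans (sym (cong length (trans (List.filter-accept (_∈ˢ? S) {xs = [ (a , d) ]} ab∈) (cong (_ ∷_) (List.filter-reject (_∈ˢ? S) {xs = []} ad∉))))) two′) λ ()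
    pick (yes ab∈) (yes ad∈) with All.lookup common (∈-filter⁺ (_∈ˢ? S) (here refl) ab∈)
    ... | inj₁ refl = corner quad≡ ab∈ ad∈ bc∉ cd∉
    ... | inj₂ 0≡b  = contradiction 0≡b (≢0 a<b)

-- A cell through `0` stays beside both diagonals (b , c) and (c , d); together with the polygon
-- sides (0 , b) and (0 , d) this leaves only the vertices 0, b, c, d. Its sides are then sides of
-- the quadrilateral as well, and `whole-cell` applies.
0∈⇒quad : ∀ {m} (D : NotchedDissection m) {c} → c ∈ NotchedDissection.cells D → 0 ∈ c →
          c ≡ NotchedDissection.quad D
0∈⇒quad {m} D = go (quad-corner D (Cell.sorted Q)) Q
  where
  open NotchedDissection D
  vs = upTo (suc m)
  vs↗ = upTo-sorted (suc m)
  2≤N : 2 ≤ suc m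
  2≤N = s≤s (ℕ.≤-trans (s≤s z≤n) 5≤m)
  diags : Diagonals vs diagonals
  diags = diagonals-upTo 2≤N dissection
  Q : Cell vs diagonals quad
  Q = cell⁻ 2≤N dissection quad∈cells
  side-vs : ∀ {x y} → (x , y) ∈ polygonSides (suc m) → Side vs x y
  side-vs = ∈-sides⁻ vs↗ (subst (2 ≤_) (sym (List.length-upTo (suc m))) 2≤N)
  go : Corner D → Cell vs diagonals quad → ∀ {e} → e ∈ cells → 0 ∈ e → e ≡ quad
  go (corner {b} {c} {d} refl 0b∈ 0d∈ bc∉ cd∉)
     (cell q↗@((0<b ∷ 0<c ∷ 0<d ∷ []) ∷ (b<c ∷ b<d ∷ []) ∷ (c<d ∷ []) ∷ [] ∷ []) q⊆ _ q-bounding q-uncut) {e} e∈ 0∈e =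
    whole-cell q↗ e↗ e⊆q e-size bounding′
    where
    open Cell (cell⁻ 2≤N dissection e∈) renaming (sorted to e↗; c⊆ to e⊆; size to e-size; bounding to e-bounding)
    q = 0 ∷ b ∷ c ∷ d ∷ []
    diagonal : ∀ {x y} → Side q x y → (x , y) ∉ polygonSides (suc m) → (x , y) ∈ diagonals
    diagonal s ∉S with q-bounding s
    ... | inj₁ s-vs = contradiction (∈-sides⁺ vs↗ s-vs) ∉S
    ... | inj₂ d∈   = d∈
    bc∈ : (b , c) ∈ diagonals
    bc∈ = diagonal (∈-sides⁻ q↗ (s≤s (s≤s z≤n)) (there (here refl))) bc∉
    cd∈ : (c , d) ∈ diagonals
    cd∈ = diagonal (∈-sides⁻ q↗ (s≤s (s≤s z≤n)) (there (there (here refl)))) cd∉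
    e⊆q : e ⊆ q
    e⊆q z∈ with ⊆-beside-diagonal vs↗ diags bc∈ (cell⁻ 2≤N dissection e∈) 0∈e (inj₁ 0<b) z∈
              | ⊆-beside-diagonal vs↗ diags cd∈ (cell⁻ 2≤N dissection e∈) 0∈e (inj₁ 0<c) z∈
    ... | inj₂ c≤z | inj₁ z≤c = there (there (here (ℕ.≤-antisym z≤c c≤z)))
    ... | inj₁ z≤b | _ with Side.kind (side-vs 0b∈)
    ...   | inj₂ ext = contradiction (proj₂ (ext (q⊆ (there (there (here refl)))))) (ℕ.<⇒≱ b<c)
    ...   | inj₁ con with con (e⊆ z∈)
    ...     | inj₁ z≤0 = here (ℕ.n≤0⇒n≡0 z≤0)
    ...     | inj₂ b≤z = there (here (ℕ.≤-antisym z≤b b≤z))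
    e⊆q z∈ | inj₂ _ | inj₂ d≤z with Side.kind (side-vs 0d∈)
    ...   | inj₂ ext = there (there (there (here (ℕ.≤-antisym (proj₂ (ext (e⊆ z∈))) d≤z))))
    ...   | inj₁ con with con (q⊆ (there (here refl)))
    ...     | inj₁ b≤0 = contradiction b≤0 (ℕ.<⇒≱ 0<b)
    ...     | inj₂ d≤b = contradiction d≤b (ℕ.<⇒≱ b<d)
    bounding′ : ∀ {x y} → Side e x y → Side q x y
    bounding′ s@(side x∈ y∈ _ _) with e-bounding s
    ... | inj₁ s-vs = side-restrict q⊆ (e⊆q x∈) (e⊆q y∈) s-vs
    ... | inj₂ d∈   = q-uncut (e⊆q x∈) (e⊆q y∈) d∈

notchedWeight : List ℕ → ℤ
notchedWeight c = if does (3 ∣? length c) then 1ℤ else 0ℤ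

notchedWeight-3∣ : ∀ {c} → 3 ∣ length c → notchedWeight c ≡ 1ℤ
notchedWeight-3∣ {c} 3∣ = cong (if_then 1ℤ else 0ℤ) (dec-true (3 ∣? length c) 3∣)

notchedWeight-3∤ : ∀ {c} → ¬ (3 ∣ length c) → notchedWeight c ≡ 0ℤ
notchedWeight-3∤ {c} 3∤ = cong (if_then 1ℤ else 0ℤ) (dec-false (3 ∣? length c) 3∤)

3∤4 : ¬ (3 ∣ 4)
3∤4 (divides (suc (suc q)) ())

count≡label : ∀ v cs → + length (filter (λ c → (3 ∣? length c) ×-dec (v ∈? c)) cs) ≡ label notchedWeight cs v
count≡label v [] = refl
count≡label v (c ∷ cs) = go (3 ∣? length c) (v ∈? c)
  where
  P? = λ c → (3 ∣? length c) ×-dec (v ∈? c)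
  reject : ¬ (3 ∣ length c × v ∈ c) → + length (filter P? (c ∷ cs)) ≡ label notchedWeight cs v
  reject ¬P = trans (cong (λ l → + length l) (List.filter-reject P? ¬P)) (count≡label v cs)
  go : Dec (3 ∣ length c) → Dec (v ∈ c) → + length (filter P? (c ∷ cs)) ≡ label notchedWeight (c ∷ cs) v
  go (yes 3∣) (yes v∈) = trans (cong (λ l → + length l) (List.filter-accept P? (3∣ , v∈)))
    (trans (cong₂ _+_ (sym (notchedWeight-3∣ {c} 3∣)) (count≡label v cs)) (sym (label-∷-∈ notchedWeight cs v∈)))
  go (no 3∤)  (yes v∈) = trans (reject (λ P → 3∤ (proj₁ P))) (trans (sym (ℤ.+-identityˡ _))
    (trans (cong (λ x → x + _) (sym (notchedWeight-3∤ {c} 3∤))) (sym (label-∷-∈ notchedWeight cs v∈))))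
  go _        (no v∉)  = trans (reject (λ P → v∉ (proj₂ P))) (sym (label-∷-∉ notchedWeight cs v∉))

3∣⇒ones≋[] : ∀ {n} → 3 ∣ n → ones n ≋ []
3∣⇒ones≋[] (divides t refl) = ones-3* t

0∷≋[]⇒≋[0] : ∀ l → 0ℤ ∷ l ≋ [] → l ≋ [ 0ℤ ]
0∷≋[]⇒≋[0] l eq = ≋-trans (≋-sym (++-congʳ l 00≋[])) (++-congˡ [ 0ℤ ] eq)

notched⇒≋ : ∀ {m} (D : NotchedDissection m) → toList (NotchedDissection.quiddity D) ≋ [ 0ℤ ]
notched⇒≋ {m} D = 0∷≋[]⇒≋[0] _ (≋-trans (≋-reflexive labels) (dissection-word 3≤N dissection notchedWeight trivial))
  where
  open NotchedDissection D
  3≤N : 3 ≤ suc m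
  3≤N = s≤s (ℕ.≤-trans (s≤s (s≤s z≤n)) 5≤m)
  quad-3∤ : ¬ (3 ∣ length quad)
  quad-3∤ 3∣ = 3∤4 (subst (3 ∣_) quad-length 3∣)
  trivial : TrivialWeights notchedWeight cells
  trivial {c} c∈ with c ≟ᴾ quad
  ... | yes refl rewrite notchedWeight-3∤ {quad} quad-3∤ | quad-length = ++-cong 00≋[] 00≋[]
  ... | no c≢quad rewrite notchedWeight-3∣ {c} (others-3∣ c∈ c≢quad) = 3∣⇒ones≋[] (others-3∣ c∈ c≢quad)
  label-0 : label notchedWeight cells 0 ≡ 0ℤ
  label-0 = label-zero notchedWeight cells λ c∈ 0∈c →
    trans (cong notchedWeight (0∈⇒quad D c∈ 0∈c)) (notchedWeight-3∤ {quad} quad-3∤)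
  labels : 0ℤ ∷ toList quiddity ≡ map (label notchedWeight cells) (upTo (suc m))
  labels = cong₂ _∷_ (sym label-0) (trans (toList-tabulate (λ v → + cellCount v) suc m)
    (List.map-cong (λ v → count≡label v cells) (applyUpTo suc m)))

-- The word 0, 1, 0 inverts -1, because 1, 0, -1 is equivalent to 0; the final 0 is its own inverse.
-1∷∷ʳ0≋[]⇒≋01 : ∀ l → -1ℤ ∷ l ++ [ 0ℤ ] ≋ [] → l ≋ 0ℤ ∷ 1ℤ ∷ []
-1∷∷ʳ0≋[]⇒≋01 l eq =
  ≋-trans (≋-sym (++-congʳ l 00≋[]))
  (≋-trans (inside [ 0ℤ ] l (≋-sym (x0y≋x+y 1ℤ -1ℤ)))
  (≋-trans (≋-reflexive (sym (List.++-identityʳ (0ℤ ∷ 1ℤ ∷ 0ℤ ∷ -1ℤ ∷ l))))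
  (≋-trans (++-congˡ (0ℤ ∷ 1ℤ ∷ 0ℤ ∷ -1ℤ ∷ l) (≋-sym 00≋[]))
  (≋-trans (≋-reflexive (cong (λ l → 0ℤ ∷ 1ℤ ∷ 0ℤ ∷ -1ℤ ∷ l) (sym (List.++-assoc l [ 0ℤ ] [ 0ℤ ]))))
  (≋-trans (inside (0ℤ ∷ 1ℤ ∷ 0ℤ ∷ []) [ 0ℤ ] eq)
           (inside (0ℤ ∷ 1ℤ ∷ []) [] 00≋[]))))))

capped⇒≋ : ∀ {n} (D : CappedDissection n) → toList (CappedDissection.quiddity D) ≋ 0ℤ ∷ 1ℤ ∷ []
capped⇒≋ {n} D = -1∷∷ʳ0≋[]⇒≋01 _ (≋-trans (≋-reflexive labels) (dissection-word 3≤N dissection weight trivial))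
  where
  open CappedDissection D
  3≤N : 3 ≤ suc (suc n)
  3≤N = s≤s (s≤s (ℕ.≤-trans (s≤s z≤n) 3≤n))
  weight-Δ : weight Δ ≡ -1ℤ
  weight-Δ = cong (if_then -1ℤ else 1ℤ) (dec-true (Δ ≟ᴾ Δ) refl)
  weight-≢Δ : ∀ {c} → c ≢ Δ → weight c ≡ 1ℤ
  weight-≢Δ {c} c≢ = cong (if_then -1ℤ else 1ℤ) (dec-false (c ≟ᴾ Δ) c≢)
  trivial : TrivialWeights weight cells
  trivial {c} c∈ with c ≟ᴾ Δ
  ... | yes refl rewrite Δ-triangle = word≈ (inj₁ refl)
  ... | no c≢Δ = 3∣⇒ones≋[] (all-3∣ c∈)
  label-0 : label weight cells 0 ≡ -1ℤ
  label-0 = trans (label-unique weight cellsUnique ([] ∷ [])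
    (λ c∈ 0∈c → here (Equivalence.to (vertex0 c∈) 0∈c))
    (λ { (here refl) → Δ∈cells , Equivalence.from (vertex0 Δ∈cells) refl }))
    (cong (_+ 0ℤ) weight-Δ)
  label-last : label weight cells (suc n) ≡ 0ℤ
  label-last = trans (label-unique weight {cs′ = Δ ∷ Δ′ ∷ []} cellsUnique (((Δ′≢Δ ∘ sym) ∷ []) ∷ [] ∷ [])
    (λ c∈ v∈c → [ here , there ∘ here ]′ (Equivalence.to (vertex-1 c∈) v∈c))
    (λ { (here refl) → Δ∈cells , Equivalence.from (vertex-1 Δ∈cells) (inj₁ refl)
       ; (there (here refl)) → Δ′∈cells , Equivalence.from (vertex-1 Δ′∈cells) (inj₂ refl) }))
    (cong₂ (λ x y → x + (y + 0ℤ)) weight-Δ (weight-≢Δ Δ′≢Δ))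
  labels : -1ℤ ∷ toList quiddity ++ [ 0ℤ ] ≡ map (label weight cells) (upTo (suc (suc n)))
  labels = cong₂ _∷_ (sym label-0) (trans
    (cong₂ _++_ (toList-tabulate weightSum suc n) (cong [_] (sym label-last)))
    (trans (sym (List.map-++ weightSum (applyUpTo suc n) [ suc n ]))
           (cong (map weightSum) (List.applyUpTo-∷ʳ suc n))))

-- From matrices to dissections

toDissection : ∀ {N ds cs} → 2 ≤ N → Dissects (upTo N) ds cs → Dissection N
toDissection {N} {ds} {cs} 2≤N (D , C) = record
  { diagonals        = ds
  ; areDiagonals     = All.tabulate λ d∈ → let x∈ , y∈ , x<y = Diagonals.ends D d∈ in
      x<y , ∈-upTo⁻ y∈ , λ s∈ → Diagonals.notSide D d∈
        (∈-sides⁻ (upTo-sorted N) (subst (2 ≤_) (sym (List.length-upTo N)) 2≤N) s∈)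
  ; nonCrossing      = Diagonals.nonCrossing D
  ; cells            = cs
  ; cellsUnique      = Cells.unique C
  ; cells⇔subPolygon = λ vs → mk⇔ (cell⇒subPolygon ∘ Cells.cells⁻ C) (Cells.cells⁺ C ∘ subPolygon⇒cell 2≤N)
  }

tabulate-≡ : ∀ (f : ℕ → ℤ) h {n} (a : Vec ℤ n) → map f (applyUpTo h n) ≡ toList a →
             tabulate (λ i → f (h (toℕ i))) ≡ a
tabulate-≡ f h []      _  = refl
tabulate-≡ f h (x ∷ a) eq = cong₂ _∷_ (List.∷-injectiveˡ eq) (tabulate-≡ f (h ∘ suc) a (List.∷-injectiveʳ eq))

toList-positive : ∀ {n} {a : Vec ℤ n} → All (0ℤ <ℤ_) a → Positive (toList a)
toList-positive []       = []
toList-positive (p ∷ ps) = p ∷ toList-positive ps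

extreme-side : ∀ {x xs y} → Sorted (x ∷ xs ++ [ y ]) → Side (x ∷ xs ++ [ y ]) x y
extreme-side {x} {xs} {y} vs↗ = Divides.side-ij-E (Divided.divided [] x xs y [] vs↗)

consecutive-side : ∀ p {x y} q → Sorted (p ++ x ∷ y ∷ q) → Side (p ++ x ∷ y ∷ q) x y
consecutive-side p {x} {y} q vs↗ = Divides.side-ij-V (Divided.divided p x [] y q vs↗)

unsnoc : ∀ {A : Set} (x : A) xs → ∃[ ys ] ∃[ y ] x ∷ xs ≡ ys ++ [ y ]
unsnoc x []       = [] , x , refl
unsnoc x (y ∷ xs) with unsnoc y xs
... | ys , z , eq = x ∷ ys , z , cong (x ∷_) eq

-- Gluing two 3d-dissections to the sides (v , k) and (k , e) of a quadrilateral.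
notched : ∀ {m} v mid₁ k mid₂ e → upTo (suc m) ≡ 0 ∷ v ∷ mid₁ ++ k ∷ mid₂ ++ [ e ] →
  1 ≤ length mid₁ → 1 ≤ length mid₂ → 5 ≤ m → ∀ {x₀ B x y C z} →
  length mid₁ ≡ length B → length mid₂ ≡ length C →
  Realization (v ∷ mid₁ ++ [ k ]) (x₀ ∷ B ++ [ x ]) →
  Realization (k ∷ mid₂ ++ [ e ]) (y ∷ C ++ [ z ]) →
  (a : Vec ℤ m) → toList a ≡ x₀ ∷ B ++ (x + y) ∷ C ++ [ z ] → IsNotchedQuiddity a
notched {m} v mid₁ k mid₂ e vs≡ 1≤mid₁ 1≤mid₂ 5≤m {x₀} {B} {x} {y} {C} {z} len₁ len₂
  (realization {ds₁} {cs₁} D₁ 3∣₁ labels₁) (realization {ds₂} {cs₂} D₂ 3∣₂ labels₂) a a≡ = N , quiddity≡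
  where
  vs V Q : List ℕ
  vs = 0 ∷ v ∷ mid₁ ++ k ∷ mid₂ ++ [ e ]
  V  = 0 ∷ v ∷ k ∷ mid₂ ++ [ e ]
  Q  = 0 ∷ v ∷ k ∷ e ∷ []
  vs↗ : Sorted vs
  vs↗ = subst Sorted vs≡ (upTo-sorted (suc m))
  V↗ : Sorted V
  V↗ = Divided.V-sorted [ 0 ] v mid₁ k (mid₂ ++ [ e ]) vs↗
  Q↗ : Sorted Q
  Q↗ = Divided.V-sorted (0 ∷ v ∷ []) k mid₂ e [] V↗
  DQ : Dissects Q [] [ Q ]
  DQ = singleDissection Q↗ (s≤s (s≤s (s≤s z≤n)))
  DV : Dissects V ((k , e) ∷ ds₂ ++ []) (cs₂ ++ [ Q ])
  DV = glueDissections (0 ∷ v ∷ []) k mid₂ e [] V↗ 1≤mid₂ (s≤s z≤n) D₂ DQ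
  cs : List (List ℕ)
  cs = cs₁ ++ cs₂ ++ [ Q ]
  ds : List Segment
  ds = (v , k) ∷ ds₁ ++ (k , e) ∷ ds₂ ++ []
  D : Dissects vs ds cs
  D = glueDissections [ 0 ] v mid₁ k (mid₂ ++ [ e ]) vs↗ 1≤mid₁ (s≤s z≤n) D₁ DV
  -- The quadrilateral contributes 0 at each of its vertices, so only `k`, where the two dissections
  -- meet, collects two labels.
  labels : map (label notchedWeight cs) vs ≡ 0ℤ ∷ (x₀ + 0ℤ) ∷ B ++ (x + (y + 0ℤ)) ∷ C ++ [ z + 0ℤ ]
  labels = gluedLabels notchedWeight [ 0 ] v mid₁ k (mid₂ ++ [ e ]) [ 0ℤ ] 0ℤ (y + 0ℤ) (C ++ [ z + 0ℤ ]) vs↗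
    (proj₂ D₁) (proj₂ DV) refl len₁ (labels₁ λ {c} _ → notchedWeight-3∣ {c})
    (gluedLabels notchedWeight (0 ∷ v ∷ []) k mid₂ e [] (0ℤ ∷ 0ℤ ∷ []) 0ℤ 0ℤ [] V↗
      (proj₂ D₂) (proj₂ DQ) refl len₂ (labels₂ λ {c} _ → notchedWeight-3∣ {c}) (labels-single notchedWeight Q))
  drop-0 : _≡_ {A = List ℤ} ((x₀ + 0ℤ) ∷ B ++ (x + (y + 0ℤ)) ∷ C ++ [ z + 0ℤ ]) (x₀ ∷ B ++ (x + y) ∷ C ++ [ z ])
  drop-0 rewrite ℤ.+-identityʳ x₀ | ℤ.+-identityʳ y | ℤ.+-identityʳ z = refl
  dissection : Dissection (suc m)
  dissection = toDissection (s≤s (ℕ.≤-trans (s≤s z≤n) 5≤m)) (subst (λ us → Dissects us ds cs) (sym vs≡) D)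
  S = polygonSides (suc m)
  side∈ : ∀ {a b} → Side vs a b → (a , b) ∈ S
  side∈ {a} {b} s = subst (λ us → (a , b) ∈ sides us) (sym vs≡) (∈-sides⁺ vs↗ s)
  side∉ : ∀ {a b} → (a , b) ∈ ds → (a , b) ∉ S
  side∉ d∈ = proj₂ (proj₂ (All.lookup (Dissection.areDiagonals dissection) d∈))
  on-polygon : sidesOnPolygon (suc m) Q ≡ (0 , v) ∷ (0 , e) ∷ []
  on-polygon =
    trans (List.filter-accept (_∈ˢ? S) (side∈ (consecutive-side [] _ vs↗)))
    (cong ((0 , v) ∷_)
    (trans (List.filter-reject (_∈ˢ? S) (side∉ (here refl)))
    (trans (List.filter-reject (_∈ˢ? S) (side∉ (there (∈-++⁺ʳ ds₁ (here refl)))))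
    (List.filter-accept (_∈ˢ? S) (side∈ 0e)))))
    where
    assoc : 0 ∷ (v ∷ mid₁ ++ k ∷ mid₂) ++ [ e ] ≡ vs
    assoc = cong (λ l → 0 ∷ v ∷ l) (List.++-assoc mid₁ (k ∷ mid₂) [ e ])
    0e : Side vs 0 e
    0e = subst (λ us → Side us 0 e) assoc (extreme-side {xs = v ∷ mid₁ ++ k ∷ mid₂} (subst Sorted (sym assoc) vs↗))
  cells-kind : ∀ {c} → c ∈ cs → 3 ∣ length c ⊎ c ≡ Q
  cells-kind c∈ with ∈-++⁻ cs₁ c∈
  ... | inj₁ c∈₁ = inj₁ (3∣₁ c∈₁)
  ... | inj₂ c∈′ with ∈-++⁻ cs₂ c∈′
  ...   | inj₁ c∈₂ = inj₁ (3∣₂ c∈₂)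
  ...   | inj₂ (here c≡) = inj₂ c≡
  N : NotchedDissection m
  N = record
    { 5≤m          = 5≤m
    ; dissection   = dissection
    ; quad         = Q
    ; quad∈cells   = ∈-++⁺ʳ cs₁ (∈-++⁺ʳ cs₂ (here refl))
    ; quad-length  = refl
    ; quad-unique  = λ c∈ len → [ (λ 3∣ → contradiction (subst (3 ∣_) len 3∣) 3∤4) , (λ c≡ → c≡) ]′ (cells-kind c∈)
    ; others-3∣    = λ c∈ c≢ → [ (λ 3∣ → 3∣) , (λ c≡ → contradiction c≡ c≢) ]′ (cells-kind c∈)
    ; twoSides     = cong length on-polygon
    ; commonVertex = subst (Allᴸ (0 endpointOf_)) (sym on-polygon) (inj₁ refl ∷ inj₁ refl ∷ [])
    }
  quiddity≡ : NotchedDissection.quiddity N ≡ a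
  quiddity≡ = tabulate-≡ _ suc a (trans (List.map-cong (λ u → count≡label u cs) (applyUpTo suc m))
    (List.∷-injectiveʳ (trans (cong (map (label notchedWeight cs)) vs≡) (trans labels
      (trans (cong (0ℤ ∷_) drop-0) (cong (0ℤ ∷_) (sym a≡)))))))

-- Gluing a 3d-dissection to the side (v , k) of the triangle Δ′ = v, k, n + 1.
capped : ∀ {n} v mid k → upTo (suc (suc n)) ≡ 0 ∷ v ∷ mid ++ k ∷ suc n ∷ [] →
  1 ≤ length mid → 3 ≤ n → ∀ {x B z} → length mid ≡ length B →
  Realization (v ∷ mid ++ [ k ]) (x ∷ B ++ [ z ]) →
  (a : Vec ℤ n) → toList a ≡ x ∷ B ++ [ z + 1ℤ ] → IsCappedQuiddity a
capped {n} v mid k vs≡ 1≤mid 3≤n {x} {B} {z} lenB (realization {ds₁} {cs₁} D₁ 3∣₁ labels₁) a a≡ = C , quiddity≡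
  where
  e = suc n
  vs V Δ Δ′ : List ℕ
  vs = 0 ∷ v ∷ mid ++ k ∷ e ∷ []
  V  = 0 ∷ v ∷ k ∷ e ∷ []
  Δ  = 0 ∷ v ∷ e ∷ []
  Δ′ = v ∷ k ∷ e ∷ []
  vs↗ : Sorted vs
  vs↗ = subst Sorted vs≡ (upTo-sorted (suc (suc n)))
  module A = Divided [ 0 ] v mid k [ e ] vs↗
  module B = Divided [ 0 ] v [ k ] e [] A.V-sorted
  DΔ : Dissects Δ [] [ Δ ]
  DΔ = singleDissection B.V-sorted (s≤s (s≤s (s≤s z≤n)))
  DΔ′ : Dissects Δ′ [] [ Δ′ ]
  DΔ′ = singleDissection B.E-sorted (s≤s (s≤s (s≤s z≤n)))
  DV : Dissects V [ (v , e) ] (Δ′ ∷ Δ ∷ [])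
  DV = glueDissections [ 0 ] v [ k ] e [] A.V-sorted (s≤s z≤n) (s≤s z≤n) DΔ′ DΔ
  cs : List (List ℕ)
  cs = cs₁ ++ Δ′ ∷ Δ ∷ []
  ds : List Segment
  ds = (v , k) ∷ ds₁ ++ [ (v , e) ]
  D : Dissects vs ds cs
  D = glueDissections [ 0 ] v mid k [ e ] vs↗ 1≤mid (s≤s z≤n) D₁ DV
  2≤N : 2 ≤ suc (suc n)
  2≤N = s≤s (s≤s z≤n)
  dissection : Dissection (suc (suc n))
  dissection = toDissection 2≤N (subst (λ us → Dissects us ds cs) (sym vs≡) D)
  S = polygonSides (suc (suc n))
  side∈ : ∀ {a b} → Side vs a b → (a , b) ∈ S
  side∈ {a} {b} s = subst (λ us → (a , b) ∈ sides us) (sym vs≡) (∈-sides⁺ vs↗ s)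
  side∉ : ∀ {a b} → (a , b) ∈ ds → (a , b) ∉ S
  side∉ d∈ = proj₂ (proj₂ (All.lookup (Dissection.areDiagonals dissection) d∈))
  on-polygon : sidesOnPolygon (suc (suc n)) Δ ≡ (0 , v) ∷ (0 , e) ∷ []
  on-polygon =
    trans (List.filter-accept (_∈ˢ? S) (side∈ (consecutive-side [] _ vs↗)))
    (cong ((0 , v) ∷_)
    (trans (List.filter-reject (_∈ˢ? S) (side∉ (there (∈-++⁺ʳ ds₁ (here refl)))))
    (List.filter-accept (_∈ˢ? S) (side∈ 0e))))
    where
    assoc : 0 ∷ (v ∷ mid ++ [ k ]) ++ [ e ] ≡ vs
    assoc = cong (λ l → 0 ∷ v ∷ l) (List.++-assoc mid [ k ] [ e ])
    0e : Side vs 0 e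
    0e = subst (λ us → Side us 0 e) assoc (extreme-side {xs = v ∷ mid ++ [ k ]} (subst Sorted (sym assoc) vs↗))
  cells₁⊆ : ∀ {c} → c ∈ cs₁ → c ⊆ A.E
  cells₁⊆ c∈ = Cell.c⊆ (Cells.cells⁻ (proj₂ D₁) c∈)
  0∉Δ′ : 0 ∉ Δ′
  0∉Δ′ = B.p∌E (here refl)
  cells-kind : ∀ {c} → c ∈ cs → c ∈ cs₁ ⊎ c ≡ Δ′ ⊎ c ≡ Δ
  cells-kind c∈ with ∈-++⁻ cs₁ c∈
  ... | inj₁ c∈₁               = inj₁ c∈₁
  ... | inj₂ (here c≡)         = inj₂ (inj₁ c≡)
  ... | inj₂ (there (here c≡)) = inj₂ (inj₂ c≡)
  Δ∈ : Δ ∈ cs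
  Δ∈ = ∈-++⁺ʳ cs₁ (there (here refl))
  Δ′∈ : Δ′ ∈ cs
  Δ′∈ = ∈-++⁺ʳ cs₁ (here refl)
  C : CappedDissection n
  C = record
    { 3≤n         = 3≤n
    ; dissection  = dissection
    ; all-3∣      = λ c∈ → 3∣ (cells-kind c∈)
    ; Δ           = Δ
    ; Δ∈cells     = Δ∈
    ; Δ-triangle  = refl
    ; Δ-exterior  = cong length on-polygon
    ; Δ′          = Δ′
    ; Δ′∈cells    = Δ′∈
    ; Δ′-triangle = refl
    ; Δ′≢Δ        = λ eq → 0∉Δ′ (subst (0 ∈_) (sym eq) (here refl))
    ; commonSide  = there (there (here (there (here refl))))
    ; Δ′-side     = there (here (side∈ (consecutive-side (0 ∷ v ∷ mid) [] vs↗)))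
    ; vertex0     = λ c∈ → mk⇔ (λ 0∈ → 0∈⇒ (cells-kind c∈) 0∈) (λ { refl → here refl })
    ; vertex-1    = λ c∈ → mk⇔ (λ e∈ → e∈⇒ (cells-kind c∈) e∈)
        (λ { (inj₁ refl) → there (there (here refl)) ; (inj₂ refl) → there (there (here refl)) })
    }
    where
    3∣ : ∀ {c} → c ∈ cs₁ ⊎ c ≡ Δ′ ⊎ c ≡ Δ → 3 ∣ length c
    3∣ (inj₁ c∈)          = 3∣₁ c∈
    3∣ (inj₂ (inj₁ refl)) = divides 1 refl
    3∣ (inj₂ (inj₂ refl)) = divides 1 refl
    0∈⇒ : ∀ {c} → c ∈ cs₁ ⊎ c ≡ Δ′ ⊎ c ≡ Δ → 0 ∈ c → c ≡ Δ
    0∈⇒ (inj₁ c∈)          0∈ = contradiction (cells₁⊆ c∈ 0∈) (A.p∌E (here refl))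
    0∈⇒ (inj₂ (inj₁ refl)) 0∈ = contradiction 0∈ 0∉Δ′
    0∈⇒ (inj₂ (inj₂ c≡))   _  = c≡
    e∈⇒ : ∀ {c} → c ∈ cs₁ ⊎ c ≡ Δ′ ⊎ c ≡ Δ → e ∈ c → c ≡ Δ ⊎ c ≡ Δ′
    e∈⇒ (inj₁ c∈)        e∈ = contradiction (cells₁⊆ c∈ e∈) (A.q∌E (here refl))
    e∈⇒ (inj₂ (inj₁ c≡)) _  = inj₂ c≡
    e∈⇒ (inj₂ (inj₂ c≡)) _  = inj₁ c≡
  open CappedDissection C using (weight; weightSum)
  weight-Δ : weight Δ ≡ -1ℤ
  weight-Δ = cong (if_then -1ℤ else 1ℤ) (dec-true (Δ ≟ᴾ Δ) refl)
  weight-0∉ : ∀ {c} → 0 ∉ c → weight c ≡ 1ℤ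
  weight-0∉ {c} 0∉ = cong (if_then -1ℤ else 1ℤ) (dec-false (c ≟ᴾ Δ) λ { refl → 0∉ (here refl) })
  -- At `v` and `e` the weights of `Δ` and `Δ′` cancel. At `k` only `Δ′` is added, which is the 1 by
  -- which the last letter exceeds `z`.
  labels : map weightSum vs ≡ -1ℤ ∷ (x + 0ℤ) ∷ B ++ (z + 1ℤ) ∷ 0ℤ ∷ []
  labels = gluedLabels weight [ 0 ] v mid k [ e ] [ -1ℤ ] 0ℤ 1ℤ [ 0ℤ ] vs↗
    (proj₂ D₁) (proj₂ DV) refl lenB
    (labels₁ λ c⊆ _ → weight-0∉ λ 0∈c → A.p∌E (here refl) (c⊆ 0∈c))
    (gluedLabels weight [ 0 ] v [ k ] e [] [ -1ℤ ] {1ℤ} -1ℤ {[ 1ℤ ]} {1ℤ} -1ℤ [] A.V-sorted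
      (proj₂ DΔ′) (proj₂ DΔ) refl refl
      (trans (labels-single weight Δ′) (cong (replicate 3) (weight-0∉ 0∉Δ′)))
      (trans (labels-single weight Δ) (cong (replicate 3) weight-Δ)))
  quiddity≡ : CappedDissection.quiddity C ≡ a
  quiddity≡ = tabulate-≡ weightSum suc a (List.∷ʳ-injectiveˡ (map weightSum (applyUpTo suc n)) (toList a)
    (trans (sym (List.map-++ weightSum (applyUpTo suc n) [ e ]))
    (trans (cong (map weightSum) (List.applyUpTo-∷ʳ suc n))
    (List.∷-injectiveʳ (trans (cong (map weightSum) vs≡) (trans labels (cong (-1ℤ ∷_) last-0)))))))
    where
    last-0 : _≡_ {A = List ℤ} ((x + 0ℤ) ∷ B ++ (z + 1ℤ) ∷ 0ℤ ∷ []) (toList a ++ [ 0ℤ ])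
    last-0 rewrite a≡ | ℤ.+-identityʳ x = cong (x ∷_) (sym (List.++-assoc B [ z + 1ℤ ] [ 0ℤ ]))

-- Assembling the two equivalences

≋01⇒≋[0] : ∀ l → l ++ [ 1ℤ ] ≋ 0ℤ ∷ 1ℤ ∷ [] → l ≋ [ 0ℤ ]
≋01⇒≋[0] l eq =
  ≋-trans (≋-reflexive (sym (List.++-identityʳ l)))
  (≋-trans (++-congˡ l (≋-sym 111≋[]))
  (≋-trans (≋-reflexive (sym (List.++-assoc l [ 1ℤ ] (1ℤ ∷ 1ℤ ∷ []))))
  (≋-trans (++-congʳ (1ℤ ∷ 1ℤ ∷ []) eq)
           (++-congˡ [ 0ℤ ] 111≋[]))))

-- As `1ℤ + z` is equivalent to z, 0, 1, both sides end in 0, 1, which is cancelled by appending 1,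
-- 1, 0.
≋01⇒≋[] : ∀ b z → b ++ [ 1ℤ + z ] ≋ 0ℤ ∷ 1ℤ ∷ [] → b ++ [ z ] ≋ []
≋01⇒≋[] b z eq =
  ≋-trans (≋-reflexive (sym (List.++-identityʳ (b ++ [ z ]))))
  (≋-trans (++-congˡ (b ++ [ z ]) (≋-sym cancel))
  (≋-trans (≋-reflexive (trans (List.++-assoc b [ z ] _) (sym (List.++-assoc b (z ∷ 0ℤ ∷ [ 1ℤ ]) (1ℤ ∷ 1ℤ ∷ [ 0ℤ ])))))
  (≋-trans (++-congʳ (1ℤ ∷ 1ℤ ∷ [ 0ℤ ]) (≋-trans (++-congˡ b z01≋) eq)) cancel)))
  where
  cancel : 0ℤ ∷ 1ℤ ∷ 1ℤ ∷ 1ℤ ∷ 0ℤ ∷ [] ≋ []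
  cancel = ≋-trans (inside [ 0ℤ ] [ 0ℤ ] 111≋[]) 00≋[]
  z01≋ : z ∷ 0ℤ ∷ 1ℤ ∷ [] ≋ [ 1ℤ + z ]
  z01≋ = ≋-trans (x0y≋x+y z 1ℤ) (≋-reflexive (cong [_] (ℤ.+-comm z 1ℤ)))

same-length : ∀ {A B : Set} (x : A) xs y (x′ : B) ys y′ → length xs ≡ length ys →
              length (x ∷ xs ++ [ y ]) ≡ length (x′ ∷ ys ++ [ y′ ])
same-length x xs y x′ ys y′ eq =
  trans (length-∷-∷ʳ x xs y) (trans (cong (2 ℕ.+_) eq) (sym (length-∷-∷ʳ x′ ys y′)))

1≤middle : ∀ {A B : Set} (xs : List B) (x : A) ys y → length xs ≡ length ys →
           3 ≤ length (x ∷ ys ++ [ y ]) → 1 ≤ length xs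
1≤middle xs x ys y eq 3≤ =
  subst (1 ≤_) (sym eq) (ℕ.≤-pred (ℕ.≤-pred (subst (3 ≤_) (length-∷-∷ʳ x ys y) 3≤)))

split⇒notched : ∀ {m} (a : Vec ℤ m) → Split (toList a) → IsNotchedQuiddity a
split⇒notched {m} a (split b x y c a≡ b>0 c>0 b≋ c≋) = go b c a≡
  (≋[]⇒quiddity _ b>0 (++-nonempty b) b≋) (≋[]⇒quiddity _ c>0 (λ ()) c≋)
  where
  vertices : List ℕ
  vertices = applyUpTo suc m
  go : ∀ b c → toList a ≡ b ++ (x + y) ∷ c → Quiddity (b ++ [ x ]) → Quiddity (y ∷ c) → IsNotchedQuiddity a
  go [] _ _ qb _ = contradiction (quiddity-length qb) λ { (s≤s ()) }
  go _ [] _ _ qc = contradiction (quiddity-length qc) λ { (s≤s ()) }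
  go (x₀ ∷ B) (c₀ ∷ c₁) a≡ qb qc with unsnoc c₀ c₁
  ... | C , z , c≡ rewrite c≡ with splitLength (x₀ ∷ B) vertices
          (trans (List.length-applyUpTo suc m) (trans (sym (Vec.length-toList a)) (cong length a≡)))
  ...   | v ∷ mid₁ , k ∷ ws , vs≡ , len₁ , len₂ with splitLength C ws (ℕ.suc-injective len₂)
  ...     | mid₂ , e ∷ [] , refl , len₃ , _ =
    notched v mid₁ k mid₂ e (cong (0 ∷_) vs≡) 1≤mid₁ 1≤mid₂ 5≤m (ℕ.suc-injective len₁) len₃
      (realize qb (Divided.E-sorted [ 0 ] v mid₁ k (mid₂ ++ [ e ]) vs↗) (same-length v mid₁ k x₀ B x (ℕ.suc-injective len₁)))
      (realize qc (Divided.E-sorted (0 ∷ v ∷ mid₁) k mid₂ e [] vs↗) (same-length k mid₂ e y C z len₃))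
      a a≡
    where
    vs↗ : Sorted (0 ∷ v ∷ mid₁ ++ k ∷ mid₂ ++ [ e ])
    vs↗ = subst Sorted (cong (0 ∷_) vs≡) (upTo-sorted (suc m))
    1≤mid₁ : 1 ≤ length mid₁
    1≤mid₁ = 1≤middle mid₁ x₀ B x (ℕ.suc-injective len₁) (quiddity-length qb)
    1≤mid₂ : 1 ≤ length mid₂
    1≤mid₂ = 1≤middle mid₂ y C z len₃ (quiddity-length qc)
    -- Both trivial words have at least three letters, and one letter of each goes into the common
    -- vertex: 3 + 3 - 1.
    5≤m : 5 ≤ m
    5≤m = subst (5 ≤_) (trans (sym (List.length-++ (x₀ ∷ B))) (trans (cong length (sym a≡)) (Vec.length-toList a)))
      (ℕ.+-mono-≤ (s≤s (subst (1 ≤_) (ℕ.suc-injective len₁) 1≤mid₁)) (quiddity-length qc))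

notched⇐≋ : ∀ {m} (a : Vec ℤ m) → All (0ℤ <ℤ_) a → toList a ≋ [ 0ℤ ] → IsNotchedQuiddity a
notched⇐≋ a a>0 a≋ = split⇒notched a (≋[0]⇒split (toList a) (toList-positive a>0) a≋)

capped⇐≋ : ∀ {n} (a : Vec ℤ n) b z → toList a ≡ b ++ [ 1ℤ + z ] → 3 ≤ n →
           Positive (b ++ [ z ]) → b ++ [ z ] ≋ [] → IsCappedQuiddity a
capped⇐≋ {n} a b z a≡ 3≤n b>0 b≋ = go b a≡ (≋[]⇒quiddity _ b>0 (++-nonempty b) b≋)
  where
  vertices : List ℕ
  vertices = applyUpTo suc n
  go : ∀ b → toList a ≡ b ++ [ 1ℤ + z ] → Quiddity (b ++ [ z ]) → IsCappedQuiddity a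
  go [] _ q = contradiction (quiddity-length q) λ { (s≤s ()) }
  go (x ∷ B) a≡ q with splitLength (x ∷ B) vertices
          (trans (List.length-applyUpTo suc n) (trans (sym (Vec.length-toList a)) (cong length a≡)))
  ... | v ∷ mid , k ∷ [] , vs≡ , len , _ =
    capped v mid k upTo≡ (1≤middle mid x B z (ℕ.suc-injective len) (quiddity-length q)) 3≤n (ℕ.suc-injective len)
      (realize q (Divided.E-sorted [ 0 ] v mid k [ suc n ] vs↗) (same-length v mid k x B z (ℕ.suc-injective len)))
      a (trans a≡ (cong (λ u → x ∷ B ++ [ u ]) (ℤ.+-comm 1ℤ z)))
    where
    upTo≡ : upTo (suc (suc n)) ≡ 0 ∷ v ∷ mid ++ k ∷ suc n ∷ []
    upTo≡ = cong (0 ∷_) (trans (sym (List.applyUpTo-∷ʳ suc n))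
      (trans (cong (_++ [ suc n ]) vs≡) (List.++-assoc (v ∷ mid) [ k ] [ suc n ])))
    vs↗ : Sorted (0 ∷ v ∷ mid ++ k ∷ suc n ∷ [])
    vs↗ = subst Sorted upTo≡ (upTo-sorted (suc (suc n)))

mainTheorem2 : (m : ℕ) → 3 ≤ suc m →
    ((a : Vec ℤ m) → All (0ℤ <ℤ_) a →
    IsPlusMinusT (M (a ∷ʳ 1ℤ)) ⇔ IsNotchedQuiddity a)
    ×
    ((a : Vec ℤ (suc m)) → All (0ℤ <ℤ_) a → + 2 ≤ℤ last a →
    IsPlusMinusT (M a) ⇔ IsCappedQuiddity a)
mainTheorem2 m 3≤n = partI , partII
  where
  partI : (a : Vec ℤ m) → All (0ℤ <ℤ_) a → IsPlusMinusT (M (a ∷ʳ 1ℤ)) ⇔ IsNotchedQuiddity a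
  partI a a>0 = mk⇔
    (λ T → notched⇐≋ a a>0 (≋01⇒≋[0] (toList a)
      (subst (_≋ 0ℤ ∷ 1ℤ ∷ []) (Vec.toList-∷ʳ 1ℤ a) (isPlusMinusT⇒≋ (a ∷ʳ 1ℤ) T))))
    λ { (D , refl) → ≋⇒isPlusMinusT (a ∷ʳ 1ℤ)
      (≋-trans (≋-reflexive (Vec.toList-∷ʳ 1ℤ a)) (++-congʳ [ 1ℤ ] (notched⇒≋ D))) }

  partII : (a : Vec ℤ (suc m)) → All (0ℤ <ℤ_) a → 2ℤ ≤ℤ last a → IsPlusMinusT (M a) ⇔ IsCappedQuiddity a
  partII a a>0 2≤last = mk⇔ to λ { (D , refl) → ≋⇒isPlusMinusT a (capped⇒≋ D) }
    where
    to : IsPlusMinusT (M a) → IsCappedQuiddity a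
    to T with initLast a
    -- Since the last letter is at least 2, lowering it by 1 keeps the word positive, as
    -- `≋[]⇒quiddity` demands.
    ... | b , z , refl with 2≤⇒pred 2≤last
    ...   | z′ , 0<z′ , refl = capped⇐≋ a (toList b) z′ a≡ 3≤n
      (All.++⁺ (All.++⁻ˡ (toList b) (subst Positive a≡ (toList-positive a>0))) (0<z′ ∷ []))
      (≋01⇒≋[] (toList b) z′ (subst (_≋ 0ℤ ∷ 1ℤ ∷ []) a≡ (isPlusMinusT⇒≋ a T)))
      where
      a≡ = Vec.toList-∷ʳ z b
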